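{- Let $p,q$ be positive integers, $n=p+q$, $X=\{1,\dots,n\}\cup\{ -1,\dots,-n\}$, and let $\gamma=(1,\dots,p,-1,\dots,-p)(p+1,\dots,n,-(p+1),\dots,-n)\in B_n$. Then $$\mathcal{S}^B_{nc}(p,q)=\{\tau\in B_n \mid \tau\le\gamma\}.$$
   Context: $B_n$ is the hyperoctahedral group: all permutations $\tau$ of $X$ with $\tau(-i)=-\tau(i)$ for all $i$. For a permutation $\sigma$ of a finite set $S$, $\#(\sigma)$ is the number of orbits (cycles) of $\sigma$; for permutations $\tau,\gamma$ of $S$, $\#(\tau,\gamma)$ is the number of orbits of the action on $S$ of the subgroup generated by $\tau$ and $\gamma$. The set of non-crossing permutations of $S$ with respect to $\gamma$ is $\mathcal{S}_{nc}(S,\gamma)=\{\tau \in \mathrm{Sym}(S)\mid \#(\tau)+\#(\tau^{ -1}\gamma)+\#(\gamma)=|S|+2\#(\tau,\gamma)\}$. Define $\mathcal{S}^B_{nc}(p,q)=\mathcal{S}_{nc}(X,\gamma)\cap B_n$. The length $\ell_B(\tau)$ of $\tau\in B_n$ is the smallest $k$ such that $\tau$ is a product of $k$ elements of the generating set $\{(i,j)(-i,-j),\ (i,-j)(-i,j) : 1\le i<j\le n\}\cup\{(i,-i): 1\le i\le n\}$ (equivalently, $n$ minus the number of pairs $\{A,-A\}$ of orbits of $\tau$ with $A\neq -A$). The partial order on $B_n$ is: $\sigma\le\tau$ iff $\ell_B(\tau)=\ell_B(\sigma)+\ell_B(\sigma^{ -1}\tau)$. -}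

module Defs where

open import Data.Nat using (ℕ; zero; suc; _+_; _<_; _<ᵇ_)
open import Data.Fin as Fin using (Fin; toℕ; _↑ˡ_; _↑ʳ_; splitAt; _≟_)
open import Data.Fin.Permutation using (Permutation′; _⟨$⟩ʳ_; _∘ₚ_; flip; transpose; _≈_) renaming (id to idₚ)
open import Data.Bool using (Bool; true; false; _∧_; _∨_; not; if_then_else_)
open import Data.List using (List; []; _∷_; _++_; map; foldr; allFin; length)
open import Data.Bool.ListAction using (any)
open import Data.Nat.ListAction using (sum)
open import Data.Sum using ([_,_]′)
open import Data.Product using (∃; ∃₂; _×_; _,_)
open import Relation.Nullary using (¬_)
open import Relation.Nullary.Decidable using (⌊_⌋)
open import Relation.Binary.PropositionalEquality using (_≡_)
open import Function using (_∘_)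

-- Permutations of a finite set Fin m, composed right-to-left:
-- (σ · τ) x = σ (τ x).

infixl 7 _·_
_·_ : ∀ {m} → Permutation′ m → Permutation′ m → Permutation′ m
σ · τ = τ ∘ₚ σ

_⁻¹ : ∀ {m} → Permutation′ m → Permutation′ m
σ ⁻¹ = flip σ

Sub : ℕ → Set
Sub m = Fin m → Bool

img : ∀ {m} → (Fin m → Fin m) → Sub m → Sub m
img {m} f S j = any (λ i → S i ∧ ⌊ f i ≟ j ⌋) (allFin m)

step : ∀ {m} → List (Permutation′ m) → Sub m → Sub m
step gs S j = S j ∨ any (λ g → img (g ⟨$⟩ʳ_) S j ∨ img (flip g ⟨$⟩ʳ_) S j) gs

iter : ∀ {A : Set} → ℕ → (A → A) → A → A
iter zero    f a = a
iter (suc k) f a = f (iter k f a)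

-- the orbit of i under the group generated by gs
-- (m closure steps suffice, as any orbit has at most m elements)
orbit : ∀ {m} → List (Permutation′ m) → Fin m → Sub m
orbit {m} gs i = iter m (step gs) (λ j → ⌊ j ≟ i ⌋)

isRep : ∀ {m} → List (Permutation′ m) → Fin m → Bool
isRep {m} gs i = not (any (λ j → orbit gs i j ∧ (toℕ j <ᵇ toℕ i)) (allFin m))

numOrbits : ∀ {m} → List (Permutation′ m) → ℕ
numOrbits {m} gs = sum (map (λ i → if isRep gs i then 1 else 0) (allFin m))

#₁ : ∀ {m} → Permutation′ m → ℕ
#₁ σ = numOrbits (σ ∷ [])

#₂ : ∀ {m} → Permutation′ m → Permutation′ m → ℕ
#₂ τ γ = numOrbits (τ ∷ γ ∷ [])

NonCrossing : ∀ {m} → Permutation′ m → Permutation′ m → Set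
NonCrossing {m} τ γ = #₁ τ + #₁ (τ ⁻¹ · γ) + #₁ γ ≡ m + 2 * #₂ τ γ
  where open import Data.Nat using (_*_)

-- The signed set X = {1..n} ∪ {-1..-n}, encoded as Fin (n + n):
-- the element  i+1  is  pos i = i ↑ˡ n,  the element -(i+1) is ng i = n ↑ʳ i.

X : ℕ → ℕ
X n = n + n

pos : ∀ {n} → Fin n → Fin (X n)
pos {n} i = i ↑ˡ n

ng : ∀ {n} → Fin n → Fin (X n)
ng {n} i = n ↑ʳ i

neg : ∀ {n} → Fin (X n) → Fin (X n)
neg {n} x = [ ng , pos ]′ (splitAt n x)

InB : ∀ {n} → Permutation′ (X n) → Set
InB {n} τ = ∀ x → τ ⟨$⟩ʳ neg {n} x ≡ neg {n} (τ ⟨$⟩ʳ x)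

data Gen (n : ℕ) : Set where
  swapG    : (i j : Fin n) → i Fin.< j → Gen n
  swapNegG : (i j : Fin n) → i Fin.< j → Gen n
  flipG    : Fin n → Gen n

genPerm : ∀ {n} → Gen n → Permutation′ (X n)
genPerm {n} (swapG i j _)    = transpose (pos {n} i) (pos {n} j) · transpose (ng {n} i) (ng {n} j)
genPerm {n} (swapNegG i j _) = transpose (pos {n} i) (ng {n} j) · transpose (ng {n} i) (pos {n} j)
genPerm {n} (flipG i)        = transpose (pos {n} i) (ng {n} i)

prod : ∀ {n} → List (Gen n) → Permutation′ (X n)
prod = foldr (λ g acc → genPerm g · acc) idₚ

ProductOf : ∀ {n} → Permutation′ (X n) → ℕ → Set
ProductOf {n} τ k = ∃ λ (w : List (Gen n)) → length w ≡ k × prod w ≈ τ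

HasLength : ∀ {n} → Permutation′ (X n) → ℕ → Set
HasLength {n} τ k = ProductOf {n} τ k × (∀ k′ → k′ < k → ¬ ProductOf {n} τ k′)

_≤B_ : ∀ {n} → Permutation′ (X n) → Permutation′ (X n) → Set
_≤B_ {n} σ τ = ∃₂ λ a c → HasLength {n} σ a × HasLength {n} (σ ⁻¹ · τ) c × HasLength {n} τ (a + c)

cycle : ∀ {m} → List (Fin m) → Permutation′ m
cycle []           = idₚ
cycle (a ∷ [])     = idₚ
cycle (a ∷ b ∷ as) = transpose a b · cycle (b ∷ as)

γ : (p q : ℕ) → Permutation′ (X (p + q))
γ p q = cycle (map (pos {p + q}) first ++ map (ng {p + q}) first)
      · cycle (map (pos {p + q}) second ++ map (ng {p + q}) second)
  where
  first : List (Fin (p + q))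
  first = map (_↑ˡ q) (allFin p)
  second : List (Fin (p + q))
  second = map (p ↑ʳ_) (allFin q)

{-# OPTIONS --safe #-}

-- For σ ∈ Bₙ let σ̄ be the permutation induced on X/± = {1..n}.  Then
-- #σ − #σ̄ is the number of pairs {A , −A} of orbits with A ≠ −A, so that
-- ℓ_B(σ) = n − #σ + #σ̄, and z(σ) = 2#σ̄ − #σ is the number of orbits with A = −A.
-- Put κ = τ⁻¹γ and c = #(τ,γ).  As #γ = #γ̄ = 2, the condition τ ≤ γ reads
-- #τ + #κ = n + #τ̄ + #κ̄, where ≤ always holds by subadditivity of ℓ_B.
-- The genus inequality in the quotient gives #τ̄ + #κ̄ + 2 ≤ n + 2c.
-- If τ is non-crossing, #τ + #κ + 2 = 2n + 2c, and these two inequalities force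
-- τ ≤ γ.  Conversely, if τ ≤ γ, the genus inequality says z(τ) + z(κ) + 2 ≤ 2c and
-- non-crossing is equality there.  This is clear when c = 1.  Otherwise τ preserves
-- both cycles of γ, each of which is an odd permutation; a shortest word for σ
-- contains exactly z(σ) flips (i,−i), and the other generators are even, so
-- z(τ) + z(κ) ≥ 2.
module Submission where

open import Defs
open import Data.Bool using (Bool; true; false; T; T?; not; _∧_; _∨_; if_then_else_)
import Data.Bool as Bool
open import Data.Bool.ListAction using (any)
open import Data.Bool.Properties using (T-∧; T-∨; ¬-not)
open import Data.Empty using (⊥; ⊥-elim)
open import Data.Fin using (Fin; zero; suc; toℕ; fromℕ<; _≟_; splitAt; _↑ˡ_; _↑ʳ_; punchIn; punchOut)
import Data.Fin as Fin
open import Data.Fin.Permutation using (Permutation′; _⟨$⟩ʳ_; _⟨$⟩ˡ_; transpose; permutation; flip; _≈_; inverseˡ; inverseʳ) renaming (id to idₚ)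
open import Data.Fin.Properties using (injective⇒≤; pigeonhole; all?; ¬∀⟶∃¬; <-cmp; suc-injective; toℕ-injective; toℕ<n; toℕ-fromℕ<; splitAt-↑ˡ; splitAt-↑ʳ; join-splitAt; ↑ˡ-injective; ↑ʳ-injective; punchOut-injective; punchOut-cong; punchOut-punchIn; punchInᵢ≢i)
open import Data.List using (List; []; _∷_; _++_; length; map; allFin; tabulate)
open import Data.List.Membership.Propositional using (_∈_; lose)
open import Data.List.Membership.Propositional.Properties using (∈-allFin; ∈-map⁺; ∈-map⁻; ∈-++⁺ˡ; ∈-++⁺ʳ)
open import Data.List.Properties using (++-assoc; ++-identityʳ; length-++; length-map; length-tabulate; map-++; map-∘; map-cong; map-tabulate)
open import Data.List.Relation.Unary.All as All using (All; []; _∷_)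
import Data.List.Relation.Unary.All.Properties as All
open import Data.List.Relation.Unary.AllPairs using ([]; _∷_)
open import Data.List.Relation.Unary.Any as Any using (Any; here; there)
open import Data.List.Relation.Unary.Any.Properties using (any⁺; any⁻)
open import Data.List.Relation.Unary.Unique.Propositional using (Unique)
import Data.List.Relation.Unary.Unique.Propositional.Properties as Unique
open import Data.Nat using (ℕ; zero; suc; _+_; _*_; _∸_; _≤_; _<_; _<ᵇ_; z≤n; s≤s; _/_; _%_)
open import Data.Nat.DivMod using (m≡m%n+[m/n]*n; m%n<n)
open import Data.Nat.Induction using (<-wellFounded)
open import Data.Nat.ListAction using (sum)
import Data.Nat.Properties as ℕ
open import Data.Nat.Tactic.RingSolver using (solve-∀)
open import Data.Product using (∃; _×_; _,_; proj₁; proj₂)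
open import Data.Sum using (_⊎_; inj₁; inj₂; [_,_]′)
open import Data.Unit using (⊤)
open import Function using (_∘_; id)
open import Function.Bundles using (_⇔_; mk⇔; Equivalence)
open import Induction.WellFounded using (Acc; acc)
open import Level using (0ℓ)
open import Relation.Binary using (Rel; tri<; tri≈; tri>)
open import Relation.Binary.Construct.Closure.Equivalence using (EqClosure; symmetric)
open import Relation.Binary.Construct.Closure.ReflexiveTransitive using (ε; _◅_; _◅◅_)
open import Relation.Binary.Construct.Closure.Symmetric using (fwd; bwd)
open import Relation.Binary.PropositionalEquality using (_≡_; _≢_; refl; sym; trans; cong; cong₂; subst; module ≡-Reasoning)
open import Relation.Nullary using (¬_; Dec; yes; no; contradiction)
open import Relation.Nullary.Decidable using (⌊_⌋; toWitness; fromWitness; map′; _⊎-dec_)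

-- Counting equivalence classes

-- Orbit counts are never evaluated. `Classes R N` is a bijection between the classes of `R` and
-- `Fin N`; counts are compared through a map that hits every class, or by gluing two distinct
-- classes, which lowers the number by one. The length formula and the genus inequality both rest on
-- one fact: left multiplication by `(a b)` either splits a cycle or joins two. For ℓ_B, one
-- generator raises #σ̄ - #σ by at most one, which bounds every word from below, and a greedy word
-- that fixes the points one at a time attains the bound. The parity argument is what asks for this
-- particular word: γ has to be cut into its two cycles, so no letter of the words for τ and κ may
-- mix the two blocks of absolute values. The greedy choice guarantees this as soon as σ̄ preserves
-- the blocks, and it keeps the number of flips visible. All formulas are written without
-- subtraction, so ℓ_B(σ) = k appears as k + #σ = n + #σ̄.

record Classes {m : ℕ} (R : Rel (Fin m) 0ℓ) (N : ℕ) : Set where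
  field
    cls      : Fin m → Fin N
    rep      : Fin N → Fin m
    cls-rep  : ∀ i → cls (rep i) ≡ i
    sound    : ∀ {x y} → R x y → cls x ≡ cls y
    complete : ∀ {x y} → cls x ≡ cls y → R x y

  decide : ∀ x y → Dec (R x y)
  decide x y = map′ complete sound (cls x ≟ cls y)

-- Sending a class of `S` to the `R`-class of a chosen preimage of its representative is injective,
-- because `f` carries `R` into `S`.
classes-≤ : ∀ {m k N M} {R : Rel (Fin m) 0ℓ} {S : Rel (Fin k) 0ℓ} →
  Classes R N → Classes S M → (f : Fin m → Fin k) →
  (∀ {x y} → R x y → S (f x) (f y)) → (∀ s → ∃ λ x → S (f x) s) → M ≤ N
classes-≤ {N = N} {M} {R} {S} CR CS f f-cong f-surj = injective⇒≤ {f = h} h-injective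
  where
  module R = Classes CR
  module S = Classes CS
  pre : Fin M → Fin _
  pre i = proj₁ (f-surj (S.rep i))
  h : Fin M → Fin N
  h i = R.cls (pre i)
  cls-pre : ∀ i → S.cls (f (pre i)) ≡ i
  cls-pre i = trans (S.sound (proj₂ (f-surj (S.rep i)))) (S.cls-rep i)
  h-injective : ∀ {i j} → h i ≡ h j → i ≡ j
  h-injective {i} {j} eq =
    trans (sym (cls-pre i)) (trans (S.sound (f-cong (R.complete eq))) (cls-pre j))

-- The class of `b` is removed with `punchOut` and its members are sent to the class of `a`. That
-- `R′` identifies nothing more is expressed by its mapping-out property, so the same lemma serves
-- the orbits of one permutation and of two.
classes-merge : ∀ {m N} {R R′ : Rel (Fin m) 0ℓ} {a b} → Classes R N → ¬ R a b →
  (∀ {x y} → R x y → R′ x y) → R′ a b →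
  (∀ {x y z} → R′ x y → R′ x z → R′ y z) →
  (∀ {M} (f : Fin m → Fin M) → (∀ {x y} → R x y → f x ≡ f y) → f a ≡ f b →
    ∀ {x y} → R′ x y → f x ≡ f y) →
  ∃ λ N′ → N ≡ suc N′ × Classes R′ N′
classes-merge {N = zero} {a = a} C ¬ab _ _ _ _ with () ← Classes.cls C a
classes-merge {m} {suc N} {R} {R′} {a} {b} C ¬ab incl ab′ eucl least = N , refl , record
  { cls = λ x → glue (cls x)
  ; rep = λ i → rep (punchIn (cls b) i)
  ; cls-rep = λ i → trans (cong glue (cls-rep _)) (glue-punchIn i)
  ; sound = least (λ x → glue (cls x)) (cong glue ∘ sound) glue-ab
  ; complete = λ {x} {y} → glue-complete x y
  }
  where
  open Classes C
  b≢a : cls b ≢ cls a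
  b≢a eq = ¬ab (complete (sym eq))
  glue : Fin (suc N) → Fin N
  glue i with cls b ≟ i
  ... | yes _   = punchOut b≢a
  ... | no  b≢i = punchOut b≢i
  glue-punchIn : ∀ i → glue (punchIn (cls b) i) ≡ i
  glue-punchIn i with cls b ≟ punchIn (cls b) i
  ... | yes eq = contradiction (sym eq) (punchInᵢ≢i (cls b) i)
  ... | no  _  = trans (punchOut-cong (cls b) refl) (punchOut-punchIn (cls b))
  glue-ab : glue (cls a) ≡ glue (cls b)
  glue-ab with cls b ≟ cls a | cls b ≟ cls b
  ... | yes eq | _      = contradiction eq b≢a
  ... | no _   | yes _  = punchOut-cong (cls b) refl
  ... | no _   | no ¬bb = contradiction refl ¬bb
  refl′ : ∀ {x} → R′ x x
  refl′ = incl (complete refl)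
  sym′ : ∀ {x y} → R′ x y → R′ y x
  sym′ xy = eucl xy refl′
  glue-complete : ∀ x y → glue (cls x) ≡ glue (cls y) → R′ x y
  glue-complete x y eq with cls b ≟ cls x | cls b ≟ cls y
  ... | yes bx | yes by = incl (complete (trans (sym bx) by))
  ... | yes bx | no _   = eucl (incl (complete bx))
      (eucl ab′ (incl (complete (punchOut-injective b≢a _ eq))))
  ... | no _   | yes by = eucl (sym′ (incl (complete (punchOut-injective _ b≢a eq))))
      (eucl (sym′ ab′) (incl (complete by)))
  ... | no b≢x | no b≢y = incl (complete (punchOut-injective b≢x b≢y eq))

classes-unique : ∀ {m N M} {R : Rel (Fin m) 0ℓ} → Classes R N → Classes R M → N ≡ M
classes-unique C D = ℕ.≤-antisym
  (classes-≤ D C id id (λ s → s , Classes.complete C refl))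
  (classes-≤ C D id id (λ s → s , Classes.complete C refl))

-- Orbits of a list of permutations

Step : ∀ {m} → List (Permutation′ m) → Rel (Fin m) 0ℓ
Step gs x y = Any (λ g → g ⟨$⟩ʳ x ≡ y) gs

-- The closure supplies the inverses, so the classes are the orbits of the generated group.
Orb : ∀ {m} → List (Permutation′ m) → Rel (Fin m) 0ℓ
Orb gs = EqClosure (Step gs)

Orb-euclidean : ∀ {m} (gs : List (Permutation′ m)) {x y z} → Orb gs x y → Orb gs x z → Orb gs y z
Orb-euclidean gs xy xz = symmetric (Step gs) xy ◅◅ xz

Orb-least : ∀ {m} (gs : List (Permutation′ m)) {A : Set} (f : Fin m → A) →
  (∀ {x y} → Step gs x y → f x ≡ f y) → ∀ {x y} → Orb gs x y → f x ≡ f y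
Orb-least gs f h ε = refl
Orb-least gs f h (fwd s ◅ p) = trans (h s) (Orb-least gs f h p)
Orb-least gs f h (bwd s ◅ p) = trans (sym (h s)) (Orb-least gs f h p)

Orb-map : ∀ {m k} (gs : List (Permutation′ m)) (hs : List (Permutation′ k)) (f : Fin m → Fin k) →
  (∀ {x y} → Step gs x y → Orb hs (f x) (f y)) → ∀ {x y} → Orb gs x y → Orb hs (f x) (f y)
Orb-map gs hs f h ε = ε
Orb-map gs hs f h (fwd s ◅ p) = h s ◅◅ Orb-map gs hs f h p
Orb-map gs hs f h (bwd s ◅ p) = symmetric (Step hs) (h s) ◅◅ Orb-map gs hs f h p

-- Correctness of the computed orbits and of their number

count : ∀ {m} → Sub m → ℕ
count P = sum (tabulate (λ i → if P i then 1 else 0))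

record Enumeration {m : ℕ} (P : Sub m) (N : ℕ) : Set where
  field
    elem       : Fin N → Fin m
    index      : ∀ x → T (P x) → Fin N
    elem-sat   : ∀ i → T (P (elem i))
    elem-inj   : ∀ {i j} → elem i ≡ elem j → i ≡ j
    elem-index : ∀ x p → elem (index x p) ≡ x

enumerate : ∀ {m} (P : Sub m) → Enumeration P (count P)
enumerate {zero} P = record
  { elem = λ () ; index = λ () ; elem-sat = λ () ; elem-inj = λ { {()} } ; elem-index = λ () }
enumerate {suc m} P = extend (P zero) refl (enumerate (P ∘ suc))
  where
  extend : ∀ b → P zero ≡ b → Enumeration (P ∘ suc) (count (P ∘ suc)) →
    Enumeration P ((if b then 1 else 0) + count (P ∘ suc))
  extend true eq E = record
    { elem = λ { zero → zero ; (suc i) → suc (elem i) }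
    ; index = λ { zero _ → zero ; (suc x) p → suc (index x p) }
    ; elem-sat = λ { zero → subst T (sym eq) _ ; (suc i) → elem-sat i }
    ; elem-inj = λ { {zero} {zero} _ → refl ; {suc i} {suc j} e → cong suc (elem-inj (suc-injective e)) }
    ; elem-index = λ { zero _ → refl ; (suc x) p → cong suc (elem-index x p) }
    }
    where open Enumeration E
  extend false eq E = record
    { elem = suc ∘ elem
    ; index = λ { zero p → ⊥-elim (subst T eq p) ; (suc x) p → index x p }
    ; elem-sat = elem-sat
    ; elem-inj = elem-inj ∘ suc-injective
    ; elem-index = λ { zero p → ⊥-elim (subst T eq p) ; (suc x) p → cong suc (elem-index x p) }
    }
    where open Enumeration E

_⊆ₛ_ : ∀ {m} → Sub m → Sub m → Set
S ⊆ₛ S′ = ∀ x → T (S x) → T (S′ x)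

count-≤ : ∀ {m} (S : Sub m) → count S ≤ m
count-≤ S = injective⇒≤ (Enumeration.elem-inj (enumerate S))

count-mono : ∀ {m} (S S′ : Sub m) → S ⊆ₛ S′ → count S ≤ count S′
count-mono S S′ sub = injective⇒≤ {f = λ i → E′.index (E.elem i) (sub _ (E.elem-sat i))}
  (λ {i} {j} eq → E.elem-inj (trans (sym (E′.elem-index _ _)) (trans (cong E′.elem eq) (E′.elem-index _ _))))
  where
  module E = Enumeration (enumerate S)
  module E′ = Enumeration (enumerate S′)

-- This dichotomy limits how often an increasing chain of subsets can grow strictly.
count-⊆ : ∀ {m} (S S′ : Sub m) → S ⊆ₛ S′ → (S′ ⊆ₛ S) ⊎ (count S < count S′)
count-⊆ {zero} S S′ sub = inj₁ (λ ())
count-⊆ {suc m} S S′ sub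
  with S zero in eq | S′ zero in eq′ | count-⊆ (S ∘ suc) (S′ ∘ suc) (sub ∘ suc)
     | count-mono (S ∘ suc) (S′ ∘ suc) (sub ∘ suc)
... | true  | false | _ | _ = ⊥-elim (subst T eq′ (sub zero (subst T (sym eq) _)))
... | false | true  | _ | le = inj₂ (s≤s le)
... | true  | true  | inj₂ lt | _ = inj₂ (s≤s lt)
... | false | false | inj₂ lt | _ = inj₂ lt
... | true  | true  | inj₁ sup | _ = inj₁ λ { zero _ → subst T (sym eq) _ ; (suc x) → sup x }
... | false | false | inj₁ sup | _ = inj₁ λ { zero p → ⊥-elim (subst T eq′ p) ; (suc x) → sup x }

any-allFin⁺ : ∀ {m} (P : Sub m) i → T (P i) → T (any P (allFin m))
any-allFin⁺ P i p = any⁺ P (lose (∈-allFin i) p)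

any-allFin⁻ : ∀ {m} (P : Sub m) → T (any P (allFin m)) → ∃ λ i → T (P i)
any-allFin⁻ P p = Any.satisfied (any⁻ P (allFin _) p)

img⁺ : ∀ {m} (f : Fin m → Fin m) S {i j} → T (S i) → f i ≡ j → T (img f S j)
img⁺ f S {i} s eq = any-allFin⁺ _ i (Equivalence.from T-∧ (s , fromWitness eq))

img⁻ : ∀ {m} (f : Fin m → Fin m) S {j} → T (img f S j) → ∃ λ i → T (S i) × f i ≡ j
img⁻ f S p with i , q ← any-allFin⁻ _ p with s , e ← Equivalence.to (T-∧ {S i}) q = i , s , toWitness e

Near : ∀ {m} → List (Permutation′ m) → Rel (Fin m) 0ℓ
Near gs i j = Any (λ g → (g ⟨$⟩ʳ i ≡ j) ⊎ (g ⟨$⟩ʳ j ≡ i)) gs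

step⁺ : ∀ {m} (gs : List (Permutation′ m)) S {i j} → T (S i) → Near gs i j → T (step gs S j)
step⁺ gs S {i} {j} s near = Equivalence.from T-∨ (inj₂ (any⁺ _ (Any.map (λ {g} → via {g}) near)))
  where
  via : ∀ {g} → (g ⟨$⟩ʳ i ≡ j) ⊎ (g ⟨$⟩ʳ j ≡ i) →
    T (img (g ⟨$⟩ʳ_) S j ∨ img (flip g ⟨$⟩ʳ_) S j)
  via (inj₁ eq) = Equivalence.from T-∨ (inj₁ (img⁺ _ S s eq))
  via {g} (inj₂ eq) = Equivalence.from (T-∨ {img (g ⟨$⟩ʳ_) S j})
    (inj₂ (img⁺ _ S s (trans (cong (g ⟨$⟩ˡ_) (sym eq)) (inverseˡ g))))

step⁻ : ∀ {m} (gs : List (Permutation′ m)) S {j} → T (step gs S j) →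
  T (S j) ⊎ ∃ λ i → T (S i) × Near gs i j
step⁻ {m} gs S {j} p with Equivalence.to (T-∨ {S j}) p
... | inj₁ s = inj₁ s
... | inj₂ q = inj₂ (search gs (any⁻ _ gs q))
  where
  search : ∀ hs → Any (λ g → T (img (g ⟨$⟩ʳ_) S j ∨ img (flip g ⟨$⟩ʳ_) S j)) hs →
    ∃ λ i → T (S i) × Near hs i j
  search (g ∷ hs) (there r) with i , s , near ← search hs r = i , s , there near
  search (g ∷ hs) (here r) with Equivalence.to (T-∨ {img (g ⟨$⟩ʳ_) S j}) r
  ... | inj₁ u with i , s , eq ← img⁻ _ S u = i , s , here (inj₁ eq)
  ... | inj₂ u with i , s , eq ← img⁻ _ S u =
    i , s , here (inj₂ (trans (cong (g ⟨$⟩ʳ_) (sym eq)) (inverseʳ g)))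

Near⇒Orb : ∀ {m} (gs : List (Permutation′ m)) {i j} → Near gs i j → Orb gs i j
Near⇒Orb (g ∷ gs) (here (inj₁ eq)) = fwd (here eq) ◅ ε
Near⇒Orb (g ∷ gs) (here (inj₂ eq)) = bwd (here eq) ◅ ε
Near⇒Orb (g ∷ gs) (there near) = Orb-map gs (g ∷ gs) id (λ s → fwd (there s) ◅ ε) (Near⇒Orb gs near)

module _ {m : ℕ} (gs : List (Permutation′ m)) (i : Fin m) where

  reach : ℕ → Sub m
  reach k = iter k (step gs) (λ j → ⌊ j ≟ i ⌋)

  reach-sound : ∀ k {j} → T (reach k j) → Orb gs i j
  reach-sound zero p with refl ← toWitness p = ε
  reach-sound (suc k) p with step⁻ gs (reach k) p
  ... | inj₁ q = reach-sound k q
  ... | inj₂ (x , q , near) = reach-sound k q ◅◅ Near⇒Orb gs near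

  reach-mono : ∀ k → reach k ⊆ₛ reach (suc k)
  reach-mono k x p = Equivalence.from T-∨ (inj₁ p)

  Stable : ℕ → Set
  Stable k = reach (suc k) ⊆ₛ reach k

  stable-suc : ∀ k → Stable k → Stable (suc k)
  stable-suc k st x p with step⁻ gs (reach (suc k)) p
  ... | inj₁ q = q
  ... | inj₂ (y , q , near) = step⁺ gs (reach k) (st y q) near

  -- Every closure step before stabilisation adds an element. The starting singleton is not counted,
  -- since this weaker bound already exceeds the size of the set at `k = m`.
  stable-or-large : ∀ k → Stable k ⊎ (suc k ≤ count (reach (suc k)))
  stable-or-large zero with count-⊆ (reach 0) (reach 1) (reach-mono 0)
  ... | inj₁ st = inj₁ st
  ... | inj₂ lt = inj₂ (ℕ.≤-trans (s≤s z≤n) lt)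
  stable-or-large (suc k) with stable-or-large k
  ... | inj₁ st = inj₁ (stable-suc k st)
  ... | inj₂ le with count-⊆ (reach (suc k)) (reach (suc (suc k))) (reach-mono (suc k))
  ...   | inj₁ st = inj₁ st
  ...   | inj₂ lt = inj₂ (ℕ.≤-trans (s≤s le) lt)

  stable : Stable m
  stable with stable-or-large m
  ... | inj₁ st = st
  ... | inj₂ le = contradiction (ℕ.≤-trans le (count-≤ (reach (suc m)))) (ℕ.<-irrefl refl)

  reach-complete : ∀ {j} → Orb gs i j → T (reach m j)
  reach-complete = go (start m)
    where
    start : ∀ k → T (reach k i)
    start zero = fromWitness {a? = i ≟ i} refl
    start (suc k) = reach-mono k i (start k)
    near : ∀ {x y} → T (reach m x) → Near gs x y → T (reach m y)
    near p nr = stable _ (step⁺ gs (reach m) p nr)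
    go : ∀ {x y} → T (reach m x) → Orb gs x y → T (reach m y)
    go p ε = p
    go p (fwd s ◅ r) = go (near p (Any.map inj₁ s)) r
    go p (bwd s ◅ r) = go (near p (Any.map inj₂ s)) r

  isRep-minimal : T (isRep gs i) → ∀ {j} → Orb gs i j → toℕ i ≤ toℕ j
  isRep-minimal p {j} r = ℕ.≮⇒≥ λ lt → T-not p
    (any-allFin⁺ (λ j → orbit gs i j ∧ (toℕ j <ᵇ toℕ i)) j
      (Equivalence.from T-∧ (reach-complete r , ℕ.<⇒<ᵇ lt)))
    where
    T-not : ∀ {b} → T (not b) → T b → ⊥
    T-not {false} _ q = q

  ¬isRep⇒smaller : ¬ T (isRep gs i) → ∃ λ j → Orb gs i j × toℕ j < toℕ i
  ¬isRep⇒smaller ¬p with any-allFin⁻ (λ j → orbit gs i j ∧ (toℕ j <ᵇ toℕ i)) (T-not ¬p)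
    where
    T-not : ∀ {b} → ¬ T (not b) → T b
    T-not {true} _ = _
    T-not {false} ¬q = ⊥-elim (¬q _)
  ... | j , q with r , lt ← Equivalence.to (T-∧ {orbit gs i j}) q = j , reach-sound m r , ℕ.<ᵇ⇒< _ _ lt

-- Well-founded descent: an element that fails `isRep` has a smaller one in its orbit.
minimal-rep : ∀ {m} (gs : List (Permutation′ m)) x → Acc _<_ (toℕ x) →
  ∃ λ y → Orb gs x y × T (isRep gs y)
minimal-rep gs x (acc rs) with T? (isRep gs x)
... | yes p = x , ε , p
... | no ¬p with y , xy , lt ← ¬isRep⇒smaller gs x ¬p with z , yz , p ← minimal-rep gs y (rs lt) =
  z , xy ◅◅ yz , p

numOrbits≡count : ∀ {m} (gs : List (Permutation′ m)) → numOrbits gs ≡ count (isRep gs)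
numOrbits≡count gs = cong sum (map-tabulate id (λ i → if isRep gs i then 1 else 0))

-- The elements that pass `isRep` are the minima of the orbits, one for each. This is the bridge
-- from the Boolean computation to `Classes`.
orbits : ∀ {m} (gs : List (Permutation′ m)) → Classes (Orb gs) (numOrbits gs)
orbits {m} gs = subst (Classes (Orb gs)) (sym (numOrbits≡count gs)) record
  { cls = λ x → E.index (proj₁ (min x)) (proj₂ (proj₂ (min x)))
  ; rep = E.elem
  ; cls-rep = λ i → E.elem-inj (trans (E.elem-index _ _)
      (min-unique (proj₂ (proj₂ (min (E.elem i)))) (E.elem-sat i)
        (symmetric (Step gs) (proj₁ (proj₂ (min (E.elem i)))))))
  ; sound = λ {x} {y} xy → E.elem-inj (trans (E.elem-index _ _) (trans
      (min-unique (proj₂ (proj₂ (min x))) (proj₂ (proj₂ (min y)))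
        (Orb-euclidean gs (proj₁ (proj₂ (min x))) (xy ◅◅ proj₁ (proj₂ (min y)))))
      (sym (E.elem-index _ _))))
  ; complete = λ {x} {y} eq → subst (Orb gs x)
      (trans (sym (E.elem-index _ _)) (trans (cong E.elem eq) (E.elem-index _ _)))
      (proj₁ (proj₂ (min x))) ◅◅ symmetric (Step gs) (proj₁ (proj₂ (min y)))
  }
  where
  module E = Enumeration (enumerate (isRep gs))
  min : ∀ x → ∃ λ y → Orb gs x y × T (isRep gs y)
  min x = minimal-rep gs x (<-wellFounded (toℕ x))
  min-unique : ∀ {x y} → T (isRep gs x) → T (isRep gs y) → Orb gs x y → x ≡ y
  min-unique {x} {y} p q xy = toℕ-injective (ℕ.≤-antisym
    (isRep-minimal gs x p xy) (isRep-minimal gs y q (symmetric (Step gs) xy)))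

numOrbits-≤ : ∀ {m} (gs hs : List (Permutation′ m)) →
  (∀ {x y} → Step gs x y → Orb hs x y) → numOrbits hs ≤ numOrbits gs
numOrbits-≤ gs hs h = classes-≤ (orbits gs) (orbits hs) id (Orb-map gs hs id h) (λ s → s , ε)

Step-≈ : ∀ {m} {σ ρ : Permutation′ m} → σ ≈ ρ → ∀ {x y} → Step (σ ∷ []) x y → Orb (ρ ∷ []) x y
Step-≈ σ≈ρ {x} (here eq) = fwd (here (trans (sym (σ≈ρ x)) eq)) ◅ ε

#₁-cong : ∀ {m} {σ ρ : Permutation′ m} → σ ≈ ρ → #₁ σ ≡ #₁ ρ
#₁-cong {σ = σ} {ρ} σ≈ρ = ℕ.≤-antisym
  (numOrbits-≤ (ρ ∷ []) (σ ∷ []) (Step-≈ {σ = ρ} {σ} (sym ∘ σ≈ρ)))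
  (numOrbits-≤ (σ ∷ []) (ρ ∷ []) (Step-≈ {σ = σ} {ρ} σ≈ρ))

#₁-id : ∀ {m} (σ : Permutation′ m) → (∀ x → σ ⟨$⟩ʳ x ≡ x) → #₁ σ ≡ m
#₁-id σ fix = classes-unique (orbits (σ ∷ [])) record
  { cls = id ; rep = id ; cls-rep = λ _ → refl
  ; sound = Orb-least (σ ∷ []) id (λ { {x} (here eq) → trans (sym (fix x)) eq })
  ; complete = λ { refl → ε }
  }

perm-injective : ∀ {m} (σ : Permutation′ m) {x y} → σ ⟨$⟩ʳ x ≡ σ ⟨$⟩ʳ y → x ≡ y
perm-injective σ eq = trans (sym (inverseˡ σ)) (trans (cong (σ ⟨$⟩ˡ_) eq) (inverseˡ σ))

-- Transpositions

transpose-left : ∀ {m} (a b : Fin m) → transpose a b ⟨$⟩ʳ a ≡ b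
transpose-left a b with a ≟ a
... | yes _ = refl
... | no ¬p = contradiction refl ¬p

transpose-right : ∀ {m} (a b : Fin m) → transpose a b ⟨$⟩ʳ b ≡ a
transpose-right a b with b ≟ a
... | yes b≡a = b≡a
... | no _ with b ≟ b
...   | yes _ = refl
...   | no ¬p = contradiction refl ¬p

transpose-fix : ∀ {m} (a b : Fin m) {x} → x ≢ a → x ≢ b → transpose a b ⟨$⟩ʳ x ≡ x
transpose-fix a b {x} x≢a x≢b with x ≟ a
... | yes x≡a = contradiction x≡a x≢a
... | no _ with x ≟ b
...   | yes x≡b = contradiction x≡b x≢b
...   | no _ = refl

transpose-cases : ∀ {m} (a b x : Fin m) →
  (x ≡ a) ⊎ (x ≡ b) ⊎ (x ≢ a × x ≢ b)
transpose-cases a b x with x ≟ a | x ≟ b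
... | yes p | _     = inj₁ p
... | no _  | yes q = inj₂ (inj₁ q)
... | no p  | no q  = inj₂ (inj₂ (p , q))

transpose-involutive : ∀ {m} (a b x : Fin m) → transpose a b ⟨$⟩ʳ (transpose a b ⟨$⟩ʳ x) ≡ x
transpose-involutive a b x with transpose-cases a b x
... | inj₁ refl = trans (cong (transpose a b ⟨$⟩ʳ_) (transpose-left a b)) (transpose-right a b)
... | inj₂ (inj₁ refl) = trans (cong (transpose a b ⟨$⟩ʳ_) (transpose-right a b)) (transpose-left a b)
... | inj₂ (inj₂ (p , q)) =
  trans (cong (transpose a b ⟨$⟩ʳ_) (transpose-fix a b p q)) (transpose-fix a b p q)

transpose-invariant : ∀ {m} {A : Set} (f : Fin m → A) {a b} → f a ≡ f b →
  ∀ x → f (transpose a b ⟨$⟩ʳ x) ≡ f x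
transpose-invariant f {a} {b} eq x with transpose-cases a b x
... | inj₁ refl = trans (cong f (transpose-left a b)) (sym eq)
... | inj₂ (inj₁ refl) = trans (cong f (transpose-right a b)) eq
... | inj₂ (inj₂ (p , q)) = cong f (transpose-fix a b p q)

-- The class map takes the same value at `a` and `b`, hence it is invariant under their
-- transposition.
transpose-Orb : ∀ {m} (gs : List (Permutation′ m)) {a b} → Orb gs a b →
  ∀ x → Orb gs x (transpose a b ⟨$⟩ʳ x)
transpose-Orb gs ab x = Classes.complete (orbits gs)
  (sym (transpose-invariant (Classes.cls (orbits gs)) (Classes.sound (orbits gs) ab) x))

-- Cycles as forward iterates

iter-+ : ∀ {A : Set} (f : A → A) j k x → iter (j + k) f x ≡ iter j f (iter k f x)
iter-+ f zero k x = refl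
iter-+ f (suc j) k x = cong f (iter-+ f j k x)

iter-suc : ∀ {A : Set} (f : A → A) k x → iter (suc k) f x ≡ iter k f (f x)
iter-suc f k x = trans (cong (λ j → iter j f x) (ℕ.+-comm 1 k)) (iter-+ f k 1 x)

iter-* : ∀ {A : Set} (f : A → A) {d x} → iter d f x ≡ x → ∀ k → iter (k * d) f x ≡ x
iter-* f eq zero = refl
iter-* f {d} {x} eq (suc k) =
  trans (iter-+ f d (k * d) x) (trans (cong (iter d f) (iter-* f eq k)) eq)

iter-cancel : ∀ {m} (σ : Permutation′ m) k d x →
  iter k (σ ⟨$⟩ʳ_) x ≡ iter (k + d) (σ ⟨$⟩ʳ_) x → iter d (σ ⟨$⟩ʳ_) x ≡ x
iter-cancel σ zero d x eq = sym eq
iter-cancel σ (suc k) d x eq = iter-cancel σ k d x (perm-injective σ eq)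

-- Two of the m + 1 iterates with exponents 0, ..., m coincide, and injectivity cancels the smaller
-- exponent.
period : ∀ {m} (σ : Permutation′ m) x → ∃ λ d → iter (suc d) (σ ⟨$⟩ʳ_) x ≡ x
period {m} σ x with i , j , i<j , eq ← pigeonhole (ℕ.n<1+n m) (λ i → iter (toℕ i) (σ ⟨$⟩ʳ_) x) =
  d , iter-cancel σ (toℕ i) (suc d) x (trans eq (cong (λ k → iter k (σ ⟨$⟩ʳ_) x) j≡))
  where
  d = toℕ j ∸ suc (toℕ i)
  j≡ : toℕ j ≡ toℕ i + suc d
  j≡ = trans (sym (ℕ.m+[n∸m]≡n i<j)) (sym (ℕ.+-suc (toℕ i) d))

iter⇒Orb : ∀ {m} (σ : Permutation′ m) k x → Orb (σ ∷ []) x (iter k (σ ⟨$⟩ʳ_) x)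
iter⇒Orb σ zero x = ε
iter⇒Orb σ (suc k) x = iter⇒Orb σ k x ◅◅ (fwd (here refl) ◅ ε)

Orb⇒iter : ∀ {m} (σ : Permutation′ m) {x y} → Orb (σ ∷ []) x y → ∃ λ k → iter k (σ ⟨$⟩ʳ_) x ≡ y
Orb⇒iter σ ε = 0 , refl
Orb⇒iter σ {x} (fwd (here refl) ◅ r) with k , eq ← Orb⇒iter σ r = suc k , trans (iter-suc _ k x) eq
-- A backward step from `x` to `y` is replaced by the rest of the cycle: if the (d+1)-st iterate
-- returns to `y`, then d forward steps lead from `x = σ y` to `y`.
Orb⇒iter σ {x} (_◅_ {j = y} (bwd (here refl)) r) with k , eq ← Orb⇒iter σ r | d , eqd ← period σ y =
  k + d , trans (iter-+ _ k d x) (trans (cong (iter k (σ ⟨$⟩ʳ_)) (trans (sym (iter-suc _ d y)) eqd)) eq)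

least : ∀ {P : ℕ → Set} → (∀ k → Dec (P k)) → ∀ d → P d → ∃ λ k → P k × (∀ j → j < k → ¬ P j)
least P? zero p = zero , p , λ _ ()
least P? (suc d) p with P? zero
... | yes p₀ = zero , p₀ , λ _ ()
... | no ¬p₀ with k , pk , below ← least (P? ∘ suc) d p =
  suc k , pk , λ { zero _ → ¬p₀ ; (suc j) (s≤s j<k) → below j j<k }

-- Exponents may be reduced modulo the period `suc k`, so the iterates with exponent at most `k`
-- exhaust the orbit of `a`.
avoid : ∀ {m} (σ : Permutation′ m) {a b} k → iter (suc k) (σ ⟨$⟩ʳ_) a ≡ a →
  (∀ j → j ≤ k → iter j (σ ⟨$⟩ʳ_) a ≢ b) → ¬ Orb (σ ∷ []) a b
avoid σ {a} k per off ab with i , eq ← Orb⇒iter σ ab =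
  off (i % suc k) (ℕ.≤-pred (m%n<n i (suc k))) (begin
    iter (i % suc k) (σ ⟨$⟩ʳ_) a
      ≡⟨ cong (iter (i % suc k) (σ ⟨$⟩ʳ_)) (iter-* _ {suc k} per (i / suc k)) ⟨
    iter (i % suc k) (σ ⟨$⟩ʳ_) (iter (i / suc k * suc k) (σ ⟨$⟩ʳ_) a)
      ≡⟨ iter-+ _ (i % suc k) _ a ⟨
    iter (i % suc k + i / suc k * suc k) (σ ⟨$⟩ʳ_) a
      ≡⟨ cong (λ j → iter j (σ ⟨$⟩ʳ_) a) (m≡m%n+[m/n]*n i (suc k)) ⟨
    iter i (σ ⟨$⟩ʳ_) a ≡⟨ eq ⟩
    _ ∎)
  where open ≡-Reasoning

module _ {m : ℕ} (σ : Permutation′ m) {a b : Fin m} (a≢b : a ≢ b) where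

  private
    s t : Fin m → Fin m
    s = σ ⟨$⟩ʳ_
    t = transpose a b · σ ⟨$⟩ʳ_

  -- The first return of the σ-orbit of a to {a , b} decides whether
  -- multiplying by (a b) joins two cycles or splits one.
  first-return : ∃ λ k → (iter (suc k) s a ≡ a ⊎ iter (suc k) s a ≡ b) ×
    (∀ j → j < k → ¬ (iter (suc j) s a ≡ a ⊎ iter (suc j) s a ≡ b))
  first-return = least (λ k → (iter (suc k) s a ≟ a) ⊎-dec (iter (suc k) s a ≟ b))
    (proj₁ (period σ a)) (inj₁ (proj₂ (period σ a)))

  -- Until the path from `a` comes back to `a` or `b`, the transposition does not act on it.
  iter-agree : ∀ k → (∀ j → j < k → ¬ (iter (suc j) s a ≡ a ⊎ iter (suc j) s a ≡ b)) →
    iter k t a ≡ iter k s a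
  iter-agree zero off = refl
  iter-agree (suc k) off = trans (cong t (iter-agree k (λ j j<k → off j (ℕ.m≤n⇒m≤1+n j<k))))
    (transpose-fix a b (off k ℕ.≤-refl ∘ inj₁) (off k ℕ.≤-refl ∘ inj₂))

  off-b : ∀ k → (∀ j → j < k → ¬ (iter (suc j) s a ≡ a ⊎ iter (suc j) s a ≡ b)) →
    ∀ j → j ≤ k → iter j s a ≢ b
  off-b k off zero _ = a≢b
  off-b k off (suc j) j<k eq = off j j<k (inj₂ eq)

  -- With `a` and `b` in different cycles the first return is to `a`, and there the transposition
  -- diverts the path to `b`.
  joins : ¬ Orb (σ ∷ []) a b → Orb (transpose a b · σ ∷ []) a b
  joins ¬ab with first-return
  ... | k , inj₂ eq , off = contradiction (subst (Orb (σ ∷ []) a) eq (iter⇒Orb σ (suc k) a)) ¬ab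
  ... | k , inj₁ eq , off = subst (Orb (transpose a b · σ ∷ []) a)
    (trans (cong t (iter-agree k off)) (trans (cong (transpose a b ⟨$⟩ʳ_) eq) (transpose-left a b)))
    (iter⇒Orb (transpose a b · σ) (suc k) a)

  -- The first return is now to `b`; the transposition sends it back to `a`, closing a cycle that
  -- has not met `b`.
  splits : Orb (σ ∷ []) a b → ¬ Orb (transpose a b · σ ∷ []) a b
  splits ab with first-return
  ... | k , inj₁ eq , off = contradiction ab (avoid σ k eq (off-b k off))
  ... | k , inj₂ eq , off = avoid (transpose a b · σ) k
    (trans (cong t (iter-agree k off)) (trans (cong (transpose a b ⟨$⟩ʳ_) eq) (transpose-right a b)))
    (λ j j≤k eq′ → off-b k off j j≤k (trans (sym (iter-agree j (λ i i<j → off i (ℕ.≤-trans i<j j≤k)))) eq′))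

  joins-⊇ : ¬ Orb (σ ∷ []) a b → ∀ {x y} → Orb (σ ∷ []) x y → Orb (transpose a b · σ ∷ []) x y
  joins-⊇ ¬ab = Orb-map (σ ∷ []) (transpose a b · σ ∷ []) id
    (λ { {x} (here refl) → (fwd (here refl) ◅ ε) ◅◅
      symmetric _ (transpose-Orb (transpose a b · σ ∷ []) (joins ¬ab) (σ ⟨$⟩ʳ x)) })

  #₁-join : ¬ Orb (σ ∷ []) a b → #₁ σ ≡ suc (#₁ (transpose a b · σ))
  #₁-join ¬ab with N , eq , C ← classes-merge {R′ = Orb (transpose a b · σ ∷ [])}
      (orbits (σ ∷ [])) ¬ab (joins-⊇ ¬ab) (joins ¬ab) (Orb-euclidean _)
      (λ f f-σ f-ab → Orb-least (transpose a b · σ ∷ []) f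
        (λ { {x} (here refl) → trans (f-σ (fwd (here refl) ◅ ε)) (sym (transpose-invariant f f-ab (σ ⟨$⟩ʳ x))) })) =
    trans eq (cong suc (classes-unique C (orbits (transpose a b · σ ∷ []))))

-- Applying `(a b)` a second time undoes the split, so this is `#₁-join` for the product `(a b)σ`.
#₁-split : ∀ {m} (σ : Permutation′ m) {a b} → a ≢ b → Orb (σ ∷ []) a b →
  #₁ (transpose a b · σ) ≡ suc (#₁ σ)
#₁-split σ {a} {b} a≢b ab = trans (#₁-join (transpose a b · σ) a≢b (splits σ a≢b ab))
  (cong suc (#₁-cong {σ = transpose a b · (transpose a b · σ)} {σ} (λ x → transpose-involutive a b (σ ⟨$⟩ʳ x))))

#₁-transpose : ∀ {m} (σ : Permutation′ m) {a b} → a ≢ b →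
  (#₁ (transpose a b · σ) ≡ suc (#₁ σ)) ⊎ (#₁ σ ≡ suc (#₁ (transpose a b · σ)))
#₁-transpose σ {a} {b} a≢b with Classes.decide (orbits (σ ∷ [])) a b
... | yes ab = inj₁ (#₁-split σ a≢b ab)
... | no ¬ab = inj₂ (#₁-join σ a≢b ¬ab)

#₁-transpose-≤ : ∀ {m} (σ : Permutation′ m) {a b} → a ≢ b → #₁ σ ≤ suc (#₁ (transpose a b · σ))
#₁-transpose-≤ σ a≢b with #₁-transpose σ a≢b
... | inj₁ eq = ℕ.m≤n⇒m≤1+n (ℕ.≤-trans (ℕ.n≤1+n _) (ℕ.≤-reflexive (sym eq)))
... | inj₂ eq = ℕ.≤-reflexive eq

-- The genus inequality

-- The measure of the induction for the genus inequality: only the points below `k` may still move.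
FixesFrom : ∀ {m} → ℕ → Permutation′ m → Set
FixesFrom k α = ∀ x → k ≤ toℕ x → α ⟨$⟩ʳ x ≡ x

-- Passing to `α′` turns `a` into a fixed point and raises #α by one. If `a` and `b = α a` are still
-- in one orbit of `α′` and `β`, the number of joint orbits has not grown, and #(αβ) changes by only
-- one. Otherwise a joint orbit has split, which costs 2 on the right; but then `a` and `b` also lie
-- in different cycles of `α′β`, so the left side gains 2 as well.
genus-step : ∀ {m} (α β : Permutation′ m) {a} → α ⟨$⟩ʳ a ≢ a →
  let α′ = transpose a (α ⟨$⟩ʳ a) · α in
  #₁ α′ + #₁ β + #₁ (α′ · β) ≤ m + 2 * #₂ α′ β → #₁ α + #₁ β + #₁ (α · β) ≤ m + 2 * #₂ α β
genus-step {m} α β {a} αa≢a ih = by-cases (Classes.decide (orbits (α′ ∷ β ∷ [])) a b)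
  where
  open ℕ.≤-Reasoning
  b = α ⟨$⟩ʳ a
  α′ = transpose a b · α
  a≢b : a ≢ b
  a≢b = αa≢a ∘ sym
  #α′ : #₁ α′ ≡ suc (#₁ α)
  #α′ = #₁-split α a≢b (fwd (here refl) ◅ ε)
  shift : ∀ x y z → x + y + suc z ≡ suc x + y + z
  shift = solve-∀
  shift₂ : ∀ x y z → 2 + (x + y + z) ≡ suc x + y + suc z
  shift₂ = solve-∀
  double : ∀ x y → x + 2 * suc y ≡ 2 + (x + 2 * y)
  double = solve-∀

  by-cases : Dec (Orb (α′ ∷ β ∷ []) a b) → #₁ α + #₁ β + #₁ (α · β) ≤ m + 2 * #₂ α β
  by-cases (yes ab) = begin
    #₁ α + #₁ β + #₁ (α · β)           ≤⟨ ℕ.+-monoʳ-≤ (#₁ α + #₁ β) (#₁-transpose-≤ (α · β) a≢b) ⟩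
    #₁ α + #₁ β + suc (#₁ (transpose a b · (α · β)))
      ≡⟨ cong (λ k → #₁ α + #₁ β + suc k) (#₁-cong {σ = transpose a b · (α · β)} {α′ · β} (λ _ → refl)) ⟩
    #₁ α + #₁ β + suc (#₁ (α′ · β))    ≡⟨ shift (#₁ α) (#₁ β) _ ⟩
    suc (#₁ α) + #₁ β + #₁ (α′ · β)    ≡⟨ cong (λ k → k + #₁ β + #₁ (α′ · β)) #α′ ⟨
    #₁ α′ + #₁ β + #₁ (α′ · β)         ≤⟨ ih ⟩
    m + 2 * #₂ α′ β                    ≤⟨ ℕ.+-monoʳ-≤ m (ℕ.*-monoʳ-≤ 2 (numOrbits-≤ (α ∷ β ∷ []) (α′ ∷ β ∷ []) coarser)) ⟩
    m + 2 * #₂ α β                     ∎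
    where
    coarser : ∀ {x y} → Step (α ∷ β ∷ []) x y → Orb (α′ ∷ β ∷ []) x y
    coarser {x} (here refl) = fwd (here refl) ◅ symmetric _ (transpose-Orb (α′ ∷ β ∷ []) ab (α ⟨$⟩ʳ x))
    coarser (there (here eq)) = fwd (there (here eq)) ◅ ε
  by-cases (no ¬ab) = ℕ.+-cancelˡ-≤ 2 _ _ (begin
    2 + (#₁ α + #₁ β + #₁ (α · β))       ≡⟨ shift₂ (#₁ α) (#₁ β) _ ⟩
    suc (#₁ α) + #₁ β + suc (#₁ (α · β)) ≡⟨ cong₂ (λ k l → k + #₁ β + l) #α′ #γ′ ⟨
    #₁ α′ + #₁ β + #₁ (α′ · β)           ≤⟨ ih ⟩
    m + 2 * #₂ α′ β                      ≡⟨ cong (λ k → m + 2 * k) #₂′ ⟩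
    m + 2 * suc (#₂ α β)                 ≡⟨ double m _ ⟩
    2 + (m + 2 * #₂ α β)                 ∎)
    where
    #γ′ : #₁ (α′ · β) ≡ suc (#₁ (α · β))
    #γ′ = trans
      (#₁-join (α′ · β) a≢b (¬ab ∘ Orb-map (α′ · β ∷ []) (α′ ∷ β ∷ []) id
        (λ { (here refl) → fwd (there (here refl)) ◅ fwd (here refl) ◅ ε })))
      (cong suc (#₁-cong {σ = transpose a b · (α′ · β)} {α · β}
        (λ x → transpose-involutive a b (α ⟨$⟩ʳ (β ⟨$⟩ʳ x)))))
    incl : ∀ {x y} → Orb (α′ ∷ β ∷ []) x y → Orb (α ∷ β ∷ []) x y
    incl = Orb-map (α′ ∷ β ∷ []) (α ∷ β ∷ []) id λ
      { {x} (here refl) → fwd (here refl) ◅ transpose-Orb (α ∷ β ∷ []) (fwd (here refl) ◅ ε) (α ⟨$⟩ʳ x)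
      ; (there (here eq)) → fwd (there (here eq)) ◅ ε }
    #₂′ : #₂ α′ β ≡ suc (#₂ α β)
    #₂′ with N , eq , C ← classes-merge {R′ = Orb (α ∷ β ∷ [])} (orbits (α′ ∷ β ∷ [])) ¬ab incl
          (fwd (here refl) ◅ ε) (Orb-euclidean _)
          (λ f f-α′ f-ab → Orb-least (α ∷ β ∷ []) f λ
            { {x} (here refl) → trans (f-α′ (fwd (here refl) ◅ ε)) (transpose-invariant f f-ab (α ⟨$⟩ʳ x))
            ; (there (here eq)) → f-α′ (fwd (there (here eq)) ◅ ε) }) =
      trans eq (cong suc (classes-unique C (orbits (α ∷ β ∷ []))))

fix-next : ∀ {m} {α : Permutation′ m} {a} → FixesFrom (suc (toℕ a)) α → α ⟨$⟩ʳ a ≡ a → FixesFrom (toℕ a) α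
fix-next {α = α} fix αa≡a x a≤x with ℕ.m≤n⇒m<n∨m≡n a≤x
... | inj₁ a<x = fix x a<x
... | inj₂ a≡x = subst (λ y → α ⟨$⟩ʳ y ≡ y) (toℕ-injective a≡x) αa≡a

-- The highest point that may move is split off by `genus-step`. At the end `α` is the identity, and
-- the joint orbits are the cycles of `β`.
genus-from : ∀ {m} k → k ≤ m → (α β : Permutation′ m) → FixesFrom k α →
  #₁ α + #₁ β + #₁ (α · β) ≤ m + 2 * #₂ α β
genus-from {m} zero _ α β fix = begin
  #₁ α + #₁ β + #₁ (α · β)
    ≡⟨ cong₂ (λ k l → k + #₁ β + l) (#₁-id α (λ x → fix x z≤n)) (#₁-cong {σ = α · β} {β} (λ x → fix _ z≤n)) ⟩
  m + #₁ β + #₁ β                ≡⟨ rearrange m (#₁ β) ⟩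
  m + 2 * #₁ β                   ≤⟨ ℕ.+-monoʳ-≤ m (ℕ.*-monoʳ-≤ 2 (numOrbits-≤ (α ∷ β ∷ []) (β ∷ []) incl)) ⟩
  m + 2 * #₂ α β                 ∎
  where
  open ℕ.≤-Reasoning
  rearrange : ∀ x y → x + y + y ≡ x + 2 * y
  rearrange = solve-∀
  incl : ∀ {x y} → Step (α ∷ β ∷ []) x y → Orb (β ∷ []) x y
  incl {x} (here eq) = subst (Orb (β ∷ []) x) (trans (sym (fix x z≤n)) eq) ε
  incl (there s) = fwd s ◅ ε
genus-from {m} (suc k) k<m α β fix = by-cases (α ⟨$⟩ʳ a ≟ a)
  where
  a = fromℕ< k<m
  a≡k : toℕ a ≡ k
  a≡k = toℕ-fromℕ< k<m
  fix-a : FixesFrom (suc (toℕ a)) α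
  fix-a = subst (λ j → FixesFrom (suc j) α) (sym a≡k) fix
  by-cases : Dec (α ⟨$⟩ʳ a ≡ a) → #₁ α + #₁ β + #₁ (α · β) ≤ m + 2 * #₂ α β
  by-cases (yes αa≡a) = genus-from k (ℕ.<⇒≤ k<m) α β
    (subst (λ j → FixesFrom j α) a≡k (fix-next {α = α} fix-a αa≡a))
  by-cases (no αa≢a) = genus-step α β αa≢a (genus-from k (ℕ.<⇒≤ k<m) α′ β
    (subst (λ j → FixesFrom j α′) a≡k (fix-next {α = α′} fix′ (transpose-right a (α ⟨$⟩ʳ a)))))
    where
    α′ = transpose a (α ⟨$⟩ʳ a) · α
    fix′ : FixesFrom (suc (toℕ a)) α′
    fix′ x a<x = trans (cong (transpose a (α ⟨$⟩ʳ a) ⟨$⟩ʳ_) (fix-a x a<x)) (transpose-fix _ _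
      (λ { refl → ℕ.<-irrefl refl a<x })
      -- A point `x` that `α` already fixes cannot be the image of `a`, by injectivity.
      (λ x≡αa → ℕ.<-irrefl (cong toℕ (perm-injective α (trans (sym x≡αa) (sym (fix-a x a<x))))) a<x))

-- Geometrically the right side minus the left is twice the sum of the genera of the surfaces that
-- the joint orbits of `α` and `β` define.
genus : ∀ {m} (α β : Permutation′ m) → #₁ α + #₁ β + #₁ (α · β) ≤ m + 2 * #₂ α β
genus {m} α β = genus-from m ℕ.≤-refl α β (λ x m≤x → contradiction (toℕ<n x) (ℕ.≤⇒≯ m≤x))

transpose-equivariant : ∀ {m k} (f : Fin m → Fin k) → (∀ {x y} → f x ≡ f y → x ≡ y) → ∀ a b x →
  f (transpose a b ⟨$⟩ʳ x) ≡ transpose (f a) (f b) ⟨$⟩ʳ f x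
transpose-equivariant f inj a b x with transpose-cases a b x
... | inj₁ refl = trans (cong f (transpose-left a b)) (sym (transpose-left (f a) (f b)))
... | inj₂ (inj₁ refl) = trans (cong f (transpose-right a b)) (sym (transpose-right (f a) (f b)))
... | inj₂ (inj₂ (p , q)) =
  trans (cong f (transpose-fix a b p q)) (sym (transpose-fix (f a) (f b) (p ∘ inj) (q ∘ inj)))

transpose-comm : ∀ {m} (a b : Fin m) → transpose a b ≈ transpose b a
transpose-comm a b x with transpose-cases a b x
... | inj₁ refl = trans (transpose-left a b) (sym (transpose-right b a))
... | inj₂ (inj₁ refl) = trans (transpose-right a b) (sym (transpose-left b a))
... | inj₂ (inj₂ (p , q)) = trans (transpose-fix a b p q) (sym (transpose-fix b a q p))

-- Signed elements and their absolute values

module _ {n : ℕ} where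

  abs : Fin (X n) → Fin n
  abs x = [ id , id ]′ (splitAt n x)

  abs-pos : ∀ i → abs (pos i) ≡ i
  abs-pos i = cong [ id , id ]′ (splitAt-↑ˡ n i n)

  abs-ng : ∀ i → abs (ng i) ≡ i
  abs-ng i = cong [ id , id ]′ (splitAt-↑ʳ n n i)

  neg-pos : ∀ i → neg {n} (pos i) ≡ ng i
  neg-pos i = cong [ ng , pos ]′ (splitAt-↑ˡ n i n)

  neg-ng : ∀ i → neg {n} (ng i) ≡ pos i
  neg-ng i = cong [ ng , pos ]′ (splitAt-↑ʳ n n i)

  data Sign : Fin (X n) → Set where
    is-pos : ∀ (i : Fin n) → Sign (pos i)
    is-ng  : ∀ (i : Fin n) → Sign (ng i)

  sign : ∀ x → Sign x
  sign x with splitAt n x | join-splitAt n n x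
  ... | inj₁ i | refl = is-pos i
  ... | inj₂ i | refl = is-ng i

  pos≢ng : ∀ {i j} → pos {n} i ≢ ng j
  pos≢ng {i} {j} eq with () ← trans (sym (splitAt-↑ˡ n i n)) (trans (cong (splitAt n) eq) (splitAt-↑ʳ n n j))

  neg-neg : ∀ x → neg {n} (neg {n} x) ≡ x
  neg-neg x with sign x
  ... | is-pos i = trans (cong (neg {n}) (neg-pos i)) (neg-ng i)
  ... | is-ng i = trans (cong (neg {n}) (neg-ng i)) (neg-pos i)

  neg-injective : ∀ {x y} → neg {n} x ≡ neg {n} y → x ≡ y
  neg-injective {x} {y} eq = trans (sym (neg-neg x)) (trans (cong (neg {n}) eq) (neg-neg y))

  abs-neg : ∀ x → abs (neg {n} x) ≡ abs x
  abs-neg x with sign x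
  ... | is-pos i = trans (cong abs (neg-pos i)) (trans (abs-ng i) (sym (abs-pos i)))
  ... | is-ng i = trans (cong abs (neg-ng i)) (trans (abs-pos i) (sym (abs-ng i)))

  neg≢ : ∀ x → neg {n} x ≢ x
  neg≢ x eq with sign x
  ... | is-pos i = pos≢ng (trans (sym eq) (neg-pos i))
  ... | is-ng i = pos≢ng (trans (sym (neg-ng i)) eq)

  abs-≡ : ∀ x y → abs x ≡ abs y → x ≡ y ⊎ x ≡ neg {n} y
  abs-≡ x y eq with sign x | sign y
  ... | is-pos i | is-pos j = inj₁ (cong pos (trans (sym (abs-pos i)) (trans eq (abs-pos j))))
  ... | is-pos i | is-ng j = inj₂ (trans (cong pos (trans (sym (abs-pos i)) (trans eq (abs-ng j)))) (sym (neg-ng j)))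
  ... | is-ng i | is-pos j = inj₂ (trans (cong ng (trans (sym (abs-ng i)) (trans eq (abs-pos j)))) (sym (neg-pos j)))
  ... | is-ng i | is-ng j = inj₁ (cong ng (trans (sym (abs-ng i)) (trans eq (abs-ng j))))

  -- σ̄ is the permutation induced by the signed permutation σ on {1..n} = X/±.
  record Covers (σ : Permutation′ (X n)) (σ̄ : Permutation′ n) : Set where
    field
      inB   : InB {n} σ
      lifts : ∀ x → abs (σ ⟨$⟩ʳ x) ≡ σ̄ ⟨$⟩ʳ abs x

  open Covers

  InB-inverse : ∀ {σ} → InB {n} σ → InB {n} (σ ⁻¹)
  InB-inverse {σ} σB x = perm-injective σ
    (trans (inverseʳ σ) (sym (trans (σB _) (cong (neg {n}) (inverseʳ σ)))))

  InB-· : ∀ {σ ρ} → InB {n} σ → InB {n} ρ → InB {n} (σ · ρ)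
  InB-· {σ} σB ρB x = trans (cong (σ ⟨$⟩ʳ_) (ρB x)) (σB _)

  covers-· : ∀ {σ ρ σ̄ ρ̄} → Covers σ σ̄ → Covers ρ ρ̄ → Covers (σ · ρ) (σ̄ · ρ̄)
  covers-· {σ} {ρ} {σ̄} Cσ Cρ = record
    { inB = InB-· {σ} {ρ} (inB Cσ) (inB Cρ)
    ; lifts = λ x → trans (lifts Cσ _) (cong (σ̄ ⟨$⟩ʳ_) (lifts Cρ x))
    }

  covers-unique : ∀ {σ ρ σ̄ ρ̄} → Covers σ σ̄ → Covers ρ ρ̄ → σ ≈ ρ → σ̄ ≈ ρ̄
  covers-unique {σ} {ρ} {σ̄} {ρ̄} Cσ Cρ σ≈ρ i = subst (λ j → σ̄ ⟨$⟩ʳ j ≡ ρ̄ ⟨$⟩ʳ j) (abs-pos i)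
    (trans (sym (lifts Cσ _)) (trans (cong abs (σ≈ρ (pos i))) (lifts Cρ _)))

  quotient : ∀ {σ} → InB {n} σ → ∃ λ σ̄ → Covers σ σ̄
  quotient {σ} σB = σ̄ , record { inB = σB ; lifts = λ x → via-pos σ σB x }
    where
    -- Symmetry under negation makes the choice of a lift irrelevant. A general `ρ` is needed
    -- because both `σ` and its inverse are used.
    via-pos : ∀ ρ → InB {n} ρ → ∀ x → abs (ρ ⟨$⟩ʳ x) ≡ abs (ρ ⟨$⟩ʳ pos (abs x))
    via-pos ρ ρB x with abs-≡ x (pos (abs x)) (sym (abs-pos (abs x)))
    ... | inj₁ eq = cong (λ y → abs (ρ ⟨$⟩ʳ y)) eq
    ... | inj₂ eq = trans (cong (λ y → abs (ρ ⟨$⟩ʳ y)) eq) (trans (cong abs (ρB _)) (abs-neg _))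
    σ̄ : Permutation′ n
    σ̄ = permutation (λ i → abs (σ ⟨$⟩ʳ pos i)) (λ i → abs (σ ⟨$⟩ˡ pos i))
      (λ i → trans (sym (via-pos σ σB _)) (trans (cong abs (inverseʳ σ)) (abs-pos i)))
      (λ i → trans (sym (via-pos (σ ⁻¹) (InB-inverse {σ} σB) _)) (trans (cong abs (inverseˡ σ)) (abs-pos i)))

  covers-iter : ∀ {σ σ̄} → Covers σ σ̄ → ∀ k x → abs (iter k (σ ⟨$⟩ʳ_) x) ≡ iter k (σ̄ ⟨$⟩ʳ_) (abs x)
  covers-iter C zero x = refl
  covers-iter {σ̄ = σ̄} C (suc k) x = trans (lifts C _) (cong (σ̄ ⟨$⟩ʳ_) (covers-iter C k x))

  -- A path of `σ̄` lifts to a path of `σ` from `x`, which ends at one of the two lifts of the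
  -- endpoint.
  covers-Orb⁻ : ∀ {σ σ̄} → Covers σ σ̄ → ∀ x y → Orb (σ̄ ∷ []) (abs x) (abs y) →
    Orb (σ ∷ []) x y ⊎ Orb (σ ∷ []) x (neg {n} y)
  covers-Orb⁻ {σ} {σ̄} C x y r with k , eq ← Orb⇒iter σ̄ r
    with abs-≡ _ y (trans (covers-iter C k x) eq)
  ... | inj₁ p = inj₁ (subst (Orb (σ ∷ []) x) p (iter⇒Orb σ k x))
  ... | inj₂ p = inj₂ (subst (Orb (σ ∷ []) x) p (iter⇒Orb σ k x))

  covers-Orb⁺ : ∀ {σ σ̄} → Covers σ σ̄ → ∀ {x y} → Orb (σ ∷ []) x y → Orb (σ̄ ∷ []) (abs x) (abs y)
  covers-Orb⁺ {σ} {σ̄} C = Orb-map (σ ∷ []) (σ̄ ∷ []) abs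
    (λ { {x} (here refl) → fwd (here (sym (lifts C x))) ◅ ε })

  Orb-neg : ∀ {σ} → InB {n} σ → ∀ {x y} → Orb (σ ∷ []) x y → Orb (σ ∷ []) (neg {n} x) (neg {n} y)
  Orb-neg {σ} σB = Orb-map (σ ∷ []) (σ ∷ []) (neg {n}) (λ { {x} (here refl) → fwd (here (σB x)) ◅ ε })

  -- Reflections of Bₙ

  covers-flip : ∀ x {σ σ̄} → Covers σ σ̄ → Covers (transpose x (neg {n} x) · σ) σ̄
  covers-flip x {σ} C = record
    { inB = λ y → trans (cong (transpose x (neg {n} x) ⟨$⟩ʳ_) (inB C y)) (sym (flip-neg (σ ⟨$⟩ʳ y)))
    ; lifts = λ y → trans (transpose-invariant abs (sym (abs-neg x)) (σ ⟨$⟩ʳ y)) (lifts C y)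
    }
    where
    flip-neg : ∀ z → neg {n} (transpose x (neg {n} x) ⟨$⟩ʳ z) ≡ transpose x (neg {n} x) ⟨$⟩ʳ neg {n} z
    flip-neg z = trans (transpose-equivariant (neg {n}) neg-injective x _ z)
      (trans (cong (λ y → transpose (neg {n} x) y ⟨$⟩ʳ neg {n} z) (neg-neg x)) (transpose-comm (neg {n} x) x (neg {n} z)))

  -- With arbitrary signs on `x` and `y`, this covers both (i,j)(-i,-j) and (i,-j)(-i,j).
  swap : Fin (X n) → Fin (X n) → Permutation′ (X n)
  swap x y = transpose x y · transpose (neg {n} x) (neg {n} y)

  module _ {x y : Fin (X n)} (x̄≢ȳ : abs x ≢ abs y) where

    x≢y : x ≢ y
    x≢y = x̄≢ȳ ∘ cong abs

    -x≢y : neg {n} x ≢ y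
    -x≢y eq = x̄≢ȳ (trans (sym (abs-neg x)) (cong abs eq))

    -y≢x : neg {n} y ≢ x
    -y≢x eq = x̄≢ȳ (sym (trans (sym (abs-neg y)) (cong abs eq)))

    -x≢-y : neg {n} x ≢ neg {n} y
    -x≢-y = x≢y ∘ neg-injective

    -- Conjugation by `(x y)` leaves the other transposition alone, since neither -x nor -y is
    -- moved.
    swap-commute : ∀ z → transpose x y ⟨$⟩ʳ (transpose (neg {n} x) (neg {n} y) ⟨$⟩ʳ z) ≡
      transpose (neg {n} x) (neg {n} y) ⟨$⟩ʳ (transpose x y ⟨$⟩ʳ z)
    swap-commute z = trans
      (transpose-equivariant (transpose x y ⟨$⟩ʳ_) (perm-injective (transpose x y)) _ _ z)
      (cong₂ (λ u v → transpose u v ⟨$⟩ʳ (transpose x y ⟨$⟩ʳ z))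
        (transpose-fix x y (neg≢ x) -x≢y) (transpose-fix x y -y≢x (neg≢ y)))

    swap-involutive : ∀ z → swap x y ⟨$⟩ʳ (swap x y ⟨$⟩ʳ z) ≡ z
    swap-involutive z = trans
      (cong (λ w → transpose x y ⟨$⟩ʳ (transpose (neg {n} x) (neg {n} y) ⟨$⟩ʳ w)) (swap-commute z))
      (trans (cong (transpose x y ⟨$⟩ʳ_) (transpose-involutive (neg {n} x) (neg {n} y) (transpose x y ⟨$⟩ʳ z)))
        (transpose-involutive x y z))

    swap-fix : ∀ z → abs z ≢ abs x → abs z ≢ abs y → swap x y ⟨$⟩ʳ z ≡ z
    swap-fix z z̄≢x̄ z̄≢ȳ = trans
      (cong (transpose x y ⟨$⟩ʳ_) (transpose-fix _ _
        (λ eq → z̄≢x̄ (trans (cong abs eq) (abs-neg x))) (λ eq → z̄≢ȳ (trans (cong abs eq) (abs-neg y)))))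
      (transpose-fix x y (z̄≢x̄ ∘ cong abs) (z̄≢ȳ ∘ cong abs))

    swap-InB : InB {n} (swap x y)
    swap-InB z = sym (begin
      neg {n} (transpose x y ⟨$⟩ʳ (transpose (neg {n} x) (neg {n} y) ⟨$⟩ʳ z))
        ≡⟨ transpose-equivariant (neg {n}) neg-injective x y _ ⟩
      transpose (neg {n} x) (neg {n} y) ⟨$⟩ʳ neg {n} (transpose (neg {n} x) (neg {n} y) ⟨$⟩ʳ z)
        ≡⟨ cong (transpose (neg {n} x) (neg {n} y) ⟨$⟩ʳ_) (transpose-equivariant (neg {n}) neg-injective _ _ z) ⟩
      transpose (neg {n} x) (neg {n} y) ⟨$⟩ʳ
        (transpose (neg {n} (neg {n} x)) (neg {n} (neg {n} y)) ⟨$⟩ʳ neg {n} z)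
        ≡⟨ cong₂ (λ u v → transpose (neg {n} x) (neg {n} y) ⟨$⟩ʳ (transpose u v ⟨$⟩ʳ neg {n} z)) (neg-neg x) (neg-neg y) ⟩
      transpose (neg {n} x) (neg {n} y) ⟨$⟩ʳ (transpose x y ⟨$⟩ʳ neg {n} z)
        ≡⟨ swap-commute (neg {n} z) ⟨
      swap x y ⟨$⟩ʳ neg {n} z ∎)
      where open ≡-Reasoning

    swap-left : swap x y ⟨$⟩ʳ x ≡ y
    swap-left = trans (cong (transpose x y ⟨$⟩ʳ_) (transpose-fix _ _ (neg≢ x ∘ sym) (-y≢x ∘ sym)))
      (transpose-left x y)

    swap-right : swap x y ⟨$⟩ʳ y ≡ x
    swap-right = trans (cong (transpose x y ⟨$⟩ʳ_) (transpose-fix _ _ (-x≢y ∘ sym) (neg≢ y ∘ sym)))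
      (transpose-right x y)

    swap-covers : Covers (swap x y) (transpose (abs x) (abs y))
    swap-covers = record { inB = swap-InB ; lifts = lifts-swap }
      where
      via-neg : ∀ z → abs (swap x y ⟨$⟩ʳ neg {n} z) ≡ abs (swap x y ⟨$⟩ʳ z)
      via-neg z = trans (cong abs (swap-InB z)) (abs-neg _)
      at-x : abs (swap x y ⟨$⟩ʳ x) ≡ transpose (abs x) (abs y) ⟨$⟩ʳ abs x
      at-x = trans (cong abs swap-left) (sym (transpose-left (abs x) (abs y)))
      at-y : abs (swap x y ⟨$⟩ʳ y) ≡ transpose (abs x) (abs y) ⟨$⟩ʳ abs y
      at-y = trans (cong abs swap-right) (sym (transpose-right (abs x) (abs y)))
      lifts-swap : ∀ z → abs (swap x y ⟨$⟩ʳ z) ≡ transpose (abs x) (abs y) ⟨$⟩ʳ abs z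
      lifts-swap z with transpose-cases (abs x) (abs y) (abs z)
      ... | inj₂ (inj₂ (p , q)) = trans (cong abs (swap-fix z p q)) (sym (transpose-fix _ _ p q))
      ... | inj₁ eq with abs-≡ z x eq
      ...   | inj₁ refl = at-x
      ...   | inj₂ refl = trans (via-neg x) (trans at-x (cong (transpose (abs x) (abs y) ⟨$⟩ʳ_) (sym (abs-neg x))))
      lifts-swap z | inj₂ (inj₁ eq) with abs-≡ z y eq
      ...   | inj₁ refl = at-y
      ...   | inj₂ refl = trans (via-neg y) (trans at-y (cong (transpose (abs x) (abs y) ⟨$⟩ʳ_) (sym (abs-neg y))))

    -- If |x| and |y| lie in different cycles of `σ̄`, then #σ̄ drops by one while #σ drops by at
    -- most two. If they share a cycle, #σ̄ rises by one, and the point is that #σ does not drop.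
    swap-lower : ∀ {σ σ̄} → Covers σ σ̄ →
      #₁ (transpose (abs x) (abs y) · σ̄) + #₁ σ ≤ #₁ (swap x y · σ) + #₁ σ̄ + 1
    swap-lower {σ} {σ̄} C = by-cases (Classes.decide (orbits (σ̄ ∷ [])) (abs x) (abs y))
      where
      open ℕ.≤-Reasoning
      t̄σ̄ = transpose (abs x) (abs y) · σ̄
      σ₁ = transpose x y · σ
      σ₂ = transpose (neg {n} x) (neg {n} y) · σ₁
      #σ₂ : #₁ σ₂ ≡ #₁ (swap x y · σ)
      #σ₂ = #₁-cong {σ = σ₂} {swap x y · σ} (λ z → sym (swap-commute (σ ⟨$⟩ʳ z)))
      rearrange₁ : ∀ u v → u + suc (suc v) ≡ v + suc u + 1
      rearrange₁ = solve-∀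
      rearrange₂ : ∀ u v → suc u + v ≡ v + u + 1
      rearrange₂ = solve-∀
      same : Orb (σ ∷ []) x y ⊎ Orb (σ ∷ []) x (neg {n} y) → #₁ σ ≤ #₁ σ₂
      same (inj₁ xy) = ℕ.≤-pred (ℕ.≤-trans (ℕ.≤-reflexive (sym (#₁-split σ x≢y xy))) (#₁-transpose-≤ σ₁ -x≢-y))
      same (inj₂ x-y) with Classes.decide (orbits (σ ∷ [])) x y
      ... | yes xy = same (inj₁ xy)
      -- Here x is with -y, hence -x with y, and x is not with y. The first transposition joins
      -- these cycles into one that contains -x and -y, so the second one splits it.
      ... | no ¬xy = ℕ.≤-reflexive (trans (#₁-join σ x≢y ¬xy) (sym (#₁-split σ₁ -x≢-y -x-y)))
        where
        -xy : Orb (σ ∷ []) (neg {n} x) y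
        -xy = subst (Orb (σ ∷ []) (neg {n} x)) (neg-neg y) (Orb-neg {σ} (inB C) x-y)
        -x-y : Orb (σ₁ ∷ []) (neg {n} x) (neg {n} y)
        -x-y = joins-⊇ σ x≢y ¬xy -xy ◅◅ symmetric _ (joins σ x≢y ¬xy) ◅◅ joins-⊇ σ x≢y ¬xy x-y
      by-cases : Dec (Orb (σ̄ ∷ []) (abs x) (abs y)) → #₁ t̄σ̄ + #₁ σ ≤ #₁ (swap x y · σ) + #₁ σ̄ + 1
      by-cases (no ¬x̄ȳ) = begin
        #₁ t̄σ̄ + #₁ σ              ≤⟨ ℕ.+-monoʳ-≤ (#₁ t̄σ̄) (ℕ.≤-trans (#₁-transpose-≤ σ x≢y) (s≤s (#₁-transpose-≤ σ₁ -x≢-y))) ⟩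
        #₁ t̄σ̄ + suc (suc (#₁ σ₂)) ≡⟨ rearrange₁ (#₁ t̄σ̄) (#₁ σ₂) ⟩
        #₁ σ₂ + suc (#₁ t̄σ̄) + 1   ≡⟨ cong₂ (λ u v → u + v + 1) #σ₂ (sym (#₁-join σ̄ x̄≢ȳ ¬x̄ȳ)) ⟩
        #₁ (swap x y · σ) + #₁ σ̄ + 1 ∎
      by-cases (yes x̄ȳ) = begin
        #₁ t̄σ̄ + #₁ σ           ≡⟨ cong (_+ #₁ σ) (#₁-split σ̄ x̄≢ȳ x̄ȳ) ⟩
        suc (#₁ σ̄) + #₁ σ      ≡⟨ rearrange₂ (#₁ σ̄) (#₁ σ) ⟩
        #₁ σ + #₁ σ̄ + 1        ≤⟨ ℕ.+-monoˡ-≤ 1 (ℕ.+-monoˡ-≤ (#₁ σ̄) (same (covers-Orb⁻ C x y x̄ȳ))) ⟩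
        #₁ σ₂ + #₁ σ̄ + 1       ≡⟨ cong (λ u → u + #₁ σ̄ + 1) #σ₂ ⟩
        #₁ (swap x y · σ) + #₁ σ̄ + 1 ∎

  -- Lengths

  id-covers : Covers idₚ idₚ
  id-covers = record { inB = λ _ → refl ; lifts = λ _ → refl }

  covers-≈ : ∀ {σ ρ σ̄} → σ ≈ ρ → Covers σ σ̄ → Covers ρ σ̄
  covers-≈ σ≈ρ C = record
    { inB = λ x → trans (sym (σ≈ρ _)) (trans (inB C x) (cong (neg {n}) (σ≈ρ x)))
    ; lifts = λ x → trans (cong abs (sym (σ≈ρ x))) (lifts C x)
    }

  swapG-≈ : ∀ i j i<j → genPerm (swapG i j i<j) ≈ swap (pos i) (pos j)
  swapG-≈ i j i<j z = cong₂ (λ u v → transpose (pos i) (pos j) ⟨$⟩ʳ (transpose u v ⟨$⟩ʳ z))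
    (sym (neg-pos i)) (sym (neg-pos j))

  swapNegG-≈ : ∀ i j i<j → genPerm (swapNegG i j i<j) ≈ swap (pos i) (ng j)
  swapNegG-≈ i j i<j z = cong₂ (λ u v → transpose (pos i) (ng j) ⟨$⟩ʳ (transpose u v ⟨$⟩ʳ z))
    (sym (neg-pos i)) (sym (neg-ng j))

  flipG-≈ : ∀ i → genPerm (flipG i) ≈ transpose (pos i) (neg {n} (pos i))
  flipG-≈ i z = cong (λ u → transpose (pos i) u ⟨$⟩ʳ z) (sym (neg-pos i))

  abs-distinct : ∀ {x y : Fin (X n)} {i j} → i Fin.< j → abs x ≡ i → abs y ≡ j → abs x ≢ abs y
  abs-distinct i<j refl refl eq = ℕ.<-irrefl (cong toℕ eq) i<j

  -- A flip leaves `σ̄` unchanged and lowers #σ by at most one; the other generators are cases of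
  -- `swap-lower`.
  gen-lower : ∀ g {σ σ̄} → Covers σ σ̄ →
    ∃ λ ρ̄ → Covers (genPerm g · σ) ρ̄ × (#₁ ρ̄ + #₁ σ ≤ #₁ (genPerm g · σ) + #₁ σ̄ + 1)
  gen-lower g {σ} {σ̄} C = go g
    where
    use-swap : ∀ g x y → abs x ≢ abs y → genPerm g ≈ swap x y →
      ∃ λ ρ̄ → Covers (genPerm g · σ) ρ̄ × (#₁ ρ̄ + #₁ σ ≤ #₁ (genPerm g · σ) + #₁ σ̄ + 1)
    use-swap g x y x̄≢ȳ g≈ = transpose (abs x) (abs y) · σ̄ ,
      covers-≈ {swap x y · σ} {genPerm g · σ} (λ z → sym (g≈ _)) (covers-· (swap-covers x̄≢ȳ) C) ,
      subst (λ k → #₁ (transpose (abs x) (abs y) · σ̄) + #₁ σ ≤ k + #₁ σ̄ + 1)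
        (#₁-cong {σ = swap x y · σ} {genPerm g · σ} (λ z → sym (g≈ _))) (swap-lower x̄≢ȳ C)
    rearrange : ∀ u v → u + suc v ≡ v + u + 1
    rearrange = solve-∀
    go : ∀ g → ∃ λ ρ̄ → Covers (genPerm g · σ) ρ̄ × (#₁ ρ̄ + #₁ σ ≤ #₁ (genPerm g · σ) + #₁ σ̄ + 1)
    go g@(swapG i j i<j) = use-swap g (pos i) (pos j)
      (abs-distinct i<j (abs-pos i) (abs-pos j)) (swapG-≈ i j i<j)
    go g@(swapNegG i j i<j) = use-swap g (pos i) (ng j)
      (abs-distinct i<j (abs-pos i) (abs-ng j)) (swapNegG-≈ i j i<j)
    go g@(flipG i) = σ̄ ,
      covers-≈ {transpose (pos i) (neg {n} (pos i)) · σ} {genPerm g · σ} (λ z → sym (flipG-≈ i (σ ⟨$⟩ʳ z))) (covers-flip (pos i) C) ,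
      ℕ.≤-trans (ℕ.+-monoʳ-≤ (#₁ σ̄) (#₁-transpose-≤ σ pos≢ng)) (ℕ.≤-reflexive (rearrange (#₁ σ̄) _))

  -- The bounds for the single letters are added up, starting from the identity, for which the two
  -- counts are n and 2n.
  word-lower : ∀ w → ∃ λ w̄ → Covers (prod w) w̄ × (n + #₁ w̄ ≤ #₁ (prod w) + length w)
  word-lower [] = idₚ , id-covers , ℕ.≤-reflexive (trans
    (cong (n +_) (#₁-id idₚ (λ _ → refl)))
    (sym (trans (ℕ.+-identityʳ _) (#₁-id {n + n} idₚ (λ _ → refl)))))
  word-lower (g ∷ w) with w̄ , C , le ← word-lower w with ρ̄ , D , le′ ← gen-lower g C =
    ρ̄ , D , ℕ.+-cancelʳ-≤ (#₁ (prod w) + #₁ w̄) _ _ (begin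
      n + #₁ ρ̄ + (#₁ (prod w) + #₁ w̄) ≡⟨ rearrange₁ n (#₁ ρ̄) _ _ ⟩
      (n + #₁ w̄) + (#₁ ρ̄ + #₁ (prod w)) ≤⟨ ℕ.+-mono-≤ le le′ ⟩
      (#₁ (prod w) + length w) + (#₁ (prod (g ∷ w)) + #₁ w̄ + 1) ≡⟨ rearrange₂ (#₁ (prod w)) (length w) (#₁ (prod (g ∷ w))) (#₁ w̄) ⟩
      #₁ (prod (g ∷ w)) + suc (length w) + (#₁ (prod w) + #₁ w̄) ∎)
    where
    open ℕ.≤-Reasoning
    rearrange₁ : ∀ a b c d → a + b + (c + d) ≡ (a + d) + (b + c)
    rearrange₁ = solve-∀
    rearrange₂ : ∀ a l b c → (a + l) + (b + c + 1) ≡ b + suc l + (a + c)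
    rearrange₂ = solve-∀

  length-lower : ∀ {σ σ̄ k} → Covers σ σ̄ → ProductOf {n} σ k → n + #₁ σ̄ ≤ #₁ σ + k
  length-lower {σ} {σ̄} C (w , refl , w≈σ) with w̄ , D , le ← word-lower w =
    subst (λ k → n + k ≤ _) (#₁-cong {σ = w̄} {σ̄} (covers-unique {prod w} {σ} {w̄} {σ̄} D C w≈σ))
      (subst (λ k → _ ≤ k + length w) (#₁-cong {σ = prod w} {σ} w≈σ) le)

  -- Shortest words that respect a partition into blocks

  InBlocks : (Fin n → Bool) → Gen n → Set
  InBlocks blk (swapG i j _)    = blk i ≡ blk j
  InBlocks blk (swapNegG i j _) = blk i ≡ blk j
  InBlocks blk (flipG _)        = ⊤

  flipCount : Gen n → ℕ
  flipCount (swapG _ _ _)    = 0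
  flipCount (swapNegG _ _ _) = 0
  flipCount (flipG _)        = 1

  flips : List (Gen n) → ℕ
  flips w = sum (map flipCount w)

  swap-comm : ∀ x y → swap x y ≈ swap y x
  swap-comm x y z = trans (transpose-comm x y (transpose (neg {n} x) (neg {n} y) ⟨$⟩ʳ z)) (cong (transpose y x ⟨$⟩ʳ_) (transpose-comm (neg {n} x) (neg {n} y) z))

  swap-neg : ∀ {x y} → abs x ≢ abs y → swap (neg {n} x) (neg {n} y) ≈ swap x y
  swap-neg {x} {y} x̄≢ȳ z = trans
    (cong₂ (λ u v → transpose (neg {n} x) (neg {n} y) ⟨$⟩ʳ (transpose u v ⟨$⟩ʳ z)) (neg-neg x) (neg-neg y))
    (sym (swap-commute x̄≢ȳ z))

  -- The generators demand i < j and a positive first entry. Exchanging the two entries, and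
  -- negating both when `y` is negative, brings any swap with `pos i` into this form.
  swap-gen : ∀ i y → i ≢ abs y → ∃ λ g → genPerm g ≈ swap (pos i) y × flipCount g ≡ 0 ×
    (∀ blk → blk i ≡ blk (abs y) → InBlocks blk g)
  swap-gen i y i≢ȳ with sign y
  ... | is-pos j with <-cmp i j
  ...   | tri< i<j _ _ = swapG i j i<j , swapG-≈ i j i<j , refl ,
          λ blk eq → trans eq (cong blk (abs-pos j))
  ...   | tri≈ _ eq _ = contradiction (trans eq (sym (abs-pos j))) i≢ȳ
  ...   | tri> _ _ j<i = swapG j i j<i ,
          (λ z → trans (swapG-≈ j i j<i z) (swap-comm (pos j) (pos i) z)) , refl ,
          λ blk eq → sym (trans eq (cong blk (abs-pos j)))
  swap-gen i y i≢ȳ | is-ng j with <-cmp i j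
  ...   | tri< i<j _ _ = swapNegG i j i<j , swapNegG-≈ i j i<j , refl ,
          λ blk eq → trans eq (cong blk (abs-ng j))
  ...   | tri≈ _ eq _ = contradiction (trans eq (sym (abs-ng j))) i≢ȳ
  ...   | tri> _ _ j<i = swapNegG j i j<i , swapped , refl ,
          λ blk eq → sym (trans eq (cong blk (abs-ng j)))
    where
    swapped : genPerm (swapNegG j i j<i) ≈ swap (pos i) (ng j)
    swapped z = trans (swapNegG-≈ j i j<i z) (trans (swap-comm (pos j) (ng i) z)
      (trans (cong₂ (λ u v → swap u v ⟨$⟩ʳ z) (sym (neg-pos i)) (sym (neg-ng j)))
        (swap-neg (λ eq → i≢ȳ (trans (sym (abs-pos i)) eq)) z)))

  -- `word-length` and `word-flips` are the formulas for ℓ_B(σ) and z(σ). `word-blocks` will allow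
  -- the word to be cut into one word per block; for a constant `blk` it holds for every word.
  record Reduced (blk : Fin n → Bool) (σ : Permutation′ (X n)) (σ̄ : Permutation′ n) : Set where
    field
      word        : List (Gen n)
      word-prod   : prod word ≈ σ
      word-length : length word + #₁ σ ≡ n + #₁ σ̄
      word-flips  : flips word + #₁ σ ≡ 2 * #₁ σ̄
      word-blocks : All (InBlocks blk) word

  FixesPosFrom : ℕ → Permutation′ (X n) → Set
  FixesPosFrom k σ = ∀ (i : Fin n) → k ≤ toℕ i → σ ⟨$⟩ʳ pos i ≡ pos i

  fixPos-next : ∀ {σ a} → FixesPosFrom (suc (toℕ a)) σ → σ ⟨$⟩ʳ pos a ≡ pos a → FixesPosFrom (toℕ a) σ
  fixPos-next {σ} fix eq i a≤i with ℕ.m≤n⇒m<n∨m≡n a≤i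
  ... | inj₁ a<i = fix i a<i
  ... | inj₂ a≡i = subst (λ j → σ ⟨$⟩ʳ pos j ≡ pos j) (toℕ-injective a≡i) eq

  module _ (blk : Fin n → Bool) where

    reduced-id : ∀ {σ σ̄} → Covers σ σ̄ → FixesPosFrom 0 σ → Reduced blk σ σ̄
    reduced-id {σ} {σ̄} C fix = record
      { word = []
      ; word-prod = λ x → sym (σ-id x)
      ; word-length = trans #σ (cong (n +_) (sym #σ̄))
      ; word-flips = trans #σ (trans (cong (n +_) (sym (ℕ.+-identityʳ n))) (cong (2 *_) (sym #σ̄)))
      ; word-blocks = []
      }
      where
      σ-id : ∀ x → σ ⟨$⟩ʳ x ≡ x
      σ-id x with sign x
      ... | is-pos i = fix i z≤n
      ... | is-ng i = subst (λ y → σ ⟨$⟩ʳ y ≡ y) (neg-pos i) (trans (inB C (pos i)) (cong (neg {n}) (fix i z≤n)))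
      #σ : #₁ σ ≡ n + n
      #σ = #₁-id σ σ-id
      #σ̄ : #₁ σ̄ ≡ n
      #σ̄ = #₁-id σ̄ (λ i → covers-unique {σ} {idₚ} {σ̄} {idₚ} C id-covers σ-id i)

    -- Since σ sends i to -i, the flip splits a cycle of `σ` and leaves `σ̄` alone: one letter and
    -- one flip are accounted for.
    reduced-flip : ∀ {σ σ̄ i} → Covers σ σ̄ → σ ⟨$⟩ʳ pos i ≡ ng i →
      Reduced blk (transpose (pos i) (ng i) · σ) σ̄ → Reduced blk σ σ̄
    reduced-flip {σ} {σ̄} {i} C eq R = record
      { word = flipG i ∷ word
      ; word-prod = λ x → trans (cong (transpose (pos i) (ng i) ⟨$⟩ʳ_) (word-prod x)) (transpose-involutive _ _ _)
      ; word-length = trans (sym (ℕ.+-suc (length word) (#₁ σ))) (trans (cong (length word +_) (sym #σ′)) word-length)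
      ; word-flips = trans (sym (ℕ.+-suc (flips word) (#₁ σ))) (trans (cong (flips word +_) (sym #σ′)) word-flips)
      ; word-blocks = _ ∷ word-blocks
      }
      where
      open Reduced R
      #σ′ : #₁ (transpose (pos i) (ng i) · σ) ≡ suc (#₁ σ)
      #σ′ = #₁-split σ pos≢ng (fwd (here eq) ◅ ε)

    -- Both transpositions of the swap split a cycle of `σ`, and its quotient splits one of `σ̄`.
    -- Hence n + #σ̄ - #σ falls by one, and 2#σ̄ - #σ does not change: one letter, no flip.
    reduced-swap : ∀ {σ σ̄ i} → Covers σ σ̄ → let y = σ ⟨$⟩ʳ pos i in
      i ≢ abs y → blk i ≡ blk (abs y) →
      Reduced blk (swap (pos i) y · σ) (transpose i (abs y) · σ̄) → Reduced blk σ σ̄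
    reduced-swap {σ} {σ̄} {i} C i≢ȳ same R with g , g≈ , no-flip , inBlk ← swap-gen i (σ ⟨$⟩ʳ pos i) i≢ȳ = record
      { word = g ∷ word
      ; word-prod = λ x → trans (g≈ _) (trans (cong (swap (pos i) y ⟨$⟩ʳ_) (word-prod x)) (swap-involutive x̄≢ȳ _))
      ; word-length = ℕ.suc-injective (trans (rearrange₁ (length word) (#₁ σ))
          (trans (cong (length word +_) (sym #σ′)) (trans word-length (trans (cong (n +_) #σ̄′) (ℕ.+-suc n (#₁ σ̄))))))
      ; word-flips = trans (cong (λ k → k + flips word + #₁ σ) no-flip)
          (ℕ.+-cancelˡ-≡ 2 _ _ (trans (rearrange₂ (flips word) (#₁ σ)) (trans (cong (flips word +_) (sym #σ′))
            (trans word-flips (trans (cong (2 *_) #σ̄′) (rearrange₃ (#₁ σ̄)))))))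
      ; word-blocks = inBlk blk same ∷ word-blocks
      }
      where
      open Reduced R
      y = σ ⟨$⟩ʳ pos i
      rearrange₁ : ∀ l s → suc (suc l + s) ≡ l + (2 + s)
      rearrange₁ = solve-∀
      rearrange₂ : ∀ l s → 2 + (l + s) ≡ l + (2 + s)
      rearrange₂ = solve-∀
      rearrange₃ : ∀ s → 2 * suc s ≡ 2 + 2 * s
      rearrange₃ = solve-∀
      x̄≢ȳ : abs (pos i) ≢ abs y
      x̄≢ȳ eq = i≢ȳ (trans (sym (abs-pos i)) eq)
      ρ = transpose (neg {n} (pos i)) (neg {n} y) · σ
      #σ′ : #₁ (swap (pos i) y · σ) ≡ 2 + #₁ σ
      #σ′ = trans (#₁-cong {σ = swap (pos i) y · σ} {transpose (pos i) y · ρ} (λ _ → refl))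
        (trans (#₁-split ρ (x≢y x̄≢ȳ) (fwd (here (transpose-fix _ _ (-x≢y x̄≢ȳ ∘ sym) (neg≢ y ∘ sym))) ◅ ε))
          (cong suc (#₁-split σ (-x≢-y x̄≢ȳ) (fwd (here (inB C (pos i))) ◅ ε))))
      #σ̄′ : #₁ (transpose i (abs y) · σ̄) ≡ suc (#₁ σ̄)
      #σ̄′ = #₁-split σ̄ i≢ȳ (fwd (here (sym (trans (lifts C (pos i)) (cong (σ̄ ⟨$⟩ʳ_) (abs-pos i))))) ◅ ε)

    -- Greedy choice at the highest unsettled `a`: a flip if σ(a) = -a, otherwise the swap of `a`
    -- with σ(a). As `σ̄` preserves `blk`, that swap stays in one block, and the new quotient
    -- preserves `blk` again.
    reduced-from : ∀ k → k ≤ n → ∀ {σ σ̄} → Covers σ σ̄ → (∀ i → blk (σ̄ ⟨$⟩ʳ i) ≡ blk i) →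
      FixesPosFrom k σ → Reduced blk σ σ̄
    reduced-from zero _ C _ fix = reduced-id C fix
    reduced-from (suc k) k<n {σ} {σ̄} C pres fix = by-cases (y ≟ pos a) (a ≟ abs y)
      where
      a = fromℕ< k<n
      y = σ ⟨$⟩ʳ pos a
      a≡k : toℕ a ≡ k
      a≡k = toℕ-fromℕ< k<n
      fix-a : FixesPosFrom (suc (toℕ a)) σ
      fix-a = subst (λ j → FixesPosFrom (suc j) σ) (sym a≡k) fix
      σ̄a : abs y ≡ σ̄ ⟨$⟩ʳ a
      σ̄a = trans (lifts C (pos a)) (cong (σ̄ ⟨$⟩ʳ_) (abs-pos a))
      a<⇒≢ : ∀ {i} → toℕ a < toℕ i → i ≢ a
      a<⇒≢ a<i refl = ℕ.<-irrefl refl a<i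
      by-cases : Dec (y ≡ pos a) → Dec (a ≡ abs y) → Reduced blk σ σ̄
      by-cases (yes y≡a) _ = reduced-from k (ℕ.<⇒≤ k<n) C pres
        (subst (λ j → FixesPosFrom j σ) a≡k (fixPos-next {σ} fix-a y≡a))
      by-cases (no y≢a) (yes a≡ȳ) = reduced-flip C y≡-a (reduced-from k (ℕ.<⇒≤ k<n)
          (subst (λ u → Covers (transpose (pos a) u · σ) σ̄) (neg-pos a) (covers-flip (pos a) C)) pres
          (subst (λ j → FixesPosFrom j σ′) a≡k (fixPos-next {σ′} fix′
            (trans (cong (transpose (pos a) (ng a) ⟨$⟩ʳ_) y≡-a) (transpose-right (pos a) (ng a))))))
        where
        σ′ = transpose (pos a) (ng a) · σ
        y≡-a : y ≡ ng a
        y≡-a with abs-≡ y (pos a) (trans (sym a≡ȳ) (sym (abs-pos a)))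
        ... | inj₁ eq = contradiction eq y≢a
        ... | inj₂ eq = trans eq (neg-pos a)
        fix′ : FixesPosFrom (suc (toℕ a)) σ′
        fix′ i a<i = trans (cong (transpose (pos a) (ng a) ⟨$⟩ʳ_) (fix-a i a<i))
          (transpose-fix _ _ (a<⇒≢ a<i ∘ ↑ˡ-injective n i a) pos≢ng)
      by-cases (no _) (no a≢ȳ) = reduced-swap C a≢ȳ (sym (trans (cong blk σ̄a) (pres a)))
          (reduced-from k (ℕ.<⇒≤ k<n)
            (subst (λ u → Covers σ′ (transpose u (abs y) · σ̄)) (abs-pos a) (covers-· (swap-covers x̄≢ȳ) C))
            (λ i → trans (transpose-invariant blk (sym (trans (cong blk σ̄a) (pres a))) _) (pres i))
            (subst (λ j → FixesPosFrom j σ′) a≡k (fixPos-next {σ′} fix′ (swap-right x̄≢ȳ))))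
        where
        x̄≢ȳ : abs (pos a) ≢ abs y
        x̄≢ȳ eq = a≢ȳ (trans (sym (abs-pos a)) eq)
        σ′ = swap (pos a) y · σ
        fix′ : FixesPosFrom (suc (toℕ a)) σ′
        fix′ i a<i = trans (cong (swap (pos a) y ⟨$⟩ʳ_) (fix-a i a<i)) (swap-fix x̄≢ȳ (pos i)
          (λ eq → a<⇒≢ a<i (trans (sym (abs-pos i)) (trans eq (abs-pos a))))
          -- If |σ(a)| were a settled `i`, then `σ̄` would send both `a` and `i` to `i`.
          (λ eq → a<⇒≢ a<i (perm-injective σ̄ (trans
            (trans (cong (σ̄ ⟨$⟩ʳ_) (sym (abs-pos i))) (trans (sym (lifts C (pos i))) (cong abs (fix-a i a<i))))
            (trans eq σ̄a)))))

    reduced : ∀ {σ σ̄} → Covers σ σ̄ → (∀ i → blk (σ̄ ⟨$⟩ʳ i) ≡ blk i) → Reduced blk σ σ̄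
    reduced C pres = reduced-from n ℕ.≤-refl C pres (λ i n≤i → contradiction (toℕ<n i) (ℕ.≤⇒≯ n≤i))

  reduced₀ : ∀ {σ σ̄} → Covers σ σ̄ → Reduced (λ _ → true) σ σ̄
  reduced₀ C = reduced _ C (λ _ → refl)

  -- The greedy word attains the bound of `length-lower`.
  hasLength⁺ : ∀ {σ σ̄ k} → Covers σ σ̄ → k + #₁ σ ≡ n + #₁ σ̄ → HasLength {n} σ k
  hasLength⁺ {σ} {σ̄} {k} C eq =
    (word , ℕ.+-cancelʳ-≡ (#₁ σ) _ _ (trans word-length (sym eq)) , word-prod) ,
    λ k′ k′<k P → ℕ.<⇒≱ k′<k (ℕ.+-cancelʳ-≤ (#₁ σ) _ _
      (ℕ.≤-trans (ℕ.≤-reflexive eq) (ℕ.≤-trans (length-lower {σ} {σ̄} C P) (ℕ.≤-reflexive (ℕ.+-comm (#₁ σ) k′)))))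
    where open Reduced (reduced₀ C)

  hasLength⁻ : ∀ {σ σ̄ k} → Covers σ σ̄ → HasLength {n} σ k → k + #₁ σ ≡ n + #₁ σ̄
  hasLength⁻ {σ} {σ̄} {k} C (P , minimal) = ℕ.≤-antisym
    (ℕ.≤-trans (ℕ.+-monoˡ-≤ (#₁ σ) (ℕ.≮⇒≥ (λ lt → minimal (length word) lt (word , refl , word-prod))))
      (ℕ.≤-reflexive word-length))
    (ℕ.≤-trans (length-lower {σ} {σ̄} C P) (ℕ.≤-reflexive (ℕ.+-comm (#₁ σ) k)))
    where open Reduced (reduced₀ C)

-- Parity of a product of transpositions

data TranspositionProduct {m : ℕ} : ℕ → Permutation′ m → Set where
  empty : ∀ {σ} → σ ≈ idₚ → TranspositionProduct 0 σ
  times : ∀ {k σ ρ a b} → a ≢ b → σ ≈ transpose a b · ρ →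
    TranspositionProduct k ρ → TranspositionProduct (suc k) σ

-- Each further transposition changes the number of cycles by exactly one, so the left side grows by
-- 0 or 2 from its value m at the identity.
#₁-parity : ∀ {m k} {σ : Permutation′ m} → TranspositionProduct k σ → ∃ λ j → #₁ σ + k ≡ m + 2 * j
#₁-parity {m} {σ = σ} (empty σ≈id) = 0 , cong (_+ 0) (#₁-id σ σ≈id)
#₁-parity {m} {suc k} {σ} (times {ρ = ρ} {a} {b} a≢b σ≈ P) with j , eq ← #₁-parity P
  with #₁-transpose ρ a≢b
... | inj₁ up = suc j , (begin
    #₁ σ + suc k          ≡⟨ cong (_+ suc k) (trans (#₁-cong {σ = σ} {transpose a b · ρ} σ≈) up) ⟩
    suc (#₁ ρ) + suc k    ≡⟨ shift (#₁ ρ) k ⟩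
    2 + (#₁ ρ + k)        ≡⟨ cong (2 +_) eq ⟩
    2 + (m + 2 * j)       ≡⟨ double m j ⟩
    m + 2 * suc j         ∎)
  where
  open ≡-Reasoning
  shift : ∀ x y → suc x + suc y ≡ 2 + (x + y)
  shift = solve-∀
  double : ∀ x y → 2 + (x + 2 * y) ≡ x + 2 * suc y
  double = solve-∀
... | inj₂ down = j , trans (ℕ.+-suc (#₁ σ) k)
    (trans (cong (_+ k) (trans (cong suc (#₁-cong {σ = σ} {transpose a b · ρ} σ≈)) (sym down))) eq)

odd≢even : ∀ {m r s} {σ : Permutation′ m} →
  TranspositionProduct (suc (2 * r)) σ → ¬ TranspositionProduct (2 * s) σ
odd≢even {m} {r} {s} {σ} P Q with i , eqP ← #₁-parity P | j , eqQ ← #₁-parity Q =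
  ℕ.even≢odd (s + i) (r + j) (ℕ.+-cancelˡ-≡ (#₁ σ + m) _ _ (begin
    #₁ σ + m + 2 * (s + i)            ≡⟨ rearrange₁ (#₁ σ) m s i ⟩
    (#₁ σ + 2 * s) + (m + 2 * i)      ≡⟨ cong₂ _+_ eqQ (sym eqP) ⟩
    (m + 2 * j) + (#₁ σ + suc (2 * r)) ≡⟨ rearrange₂ (#₁ σ) m r j ⟩
    #₁ σ + m + suc (2 * (r + j))      ∎))
  where
  open ≡-Reasoning
  rearrange₁ : ∀ x y u v → x + y + 2 * (u + v) ≡ (x + 2 * u) + (y + 2 * v)
  rearrange₁ = solve-∀
  rearrange₂ : ∀ x y u v → (y + 2 * v) + (x + suc (2 * u)) ≡ x + y + suc (2 * (u + v))
  rearrange₂ = solve-∀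

TranspositionProduct-≈ : ∀ {m k} {σ ρ : Permutation′ m} → σ ≈ ρ →
  TranspositionProduct k ρ → TranspositionProduct k σ
TranspositionProduct-≈ σ≈ρ (empty ρ≈) = empty (λ x → trans (σ≈ρ x) (ρ≈ x))
TranspositionProduct-≈ σ≈ρ (times {ρ = π} a≢b ρ≈ P) = times {ρ = π} a≢b (λ x → trans (σ≈ρ x) (ρ≈ x)) P

-- Cycles given by lists

cycle-transpositions : ∀ {m} (a : Fin m) L → Unique (a ∷ L) → TranspositionProduct (length L) (cycle (a ∷ L))
cycle-transpositions a [] _ = empty (λ _ → refl)
cycle-transpositions a (b ∷ L) ((a≢b ∷ _) ∷ u) =
  times {ρ = cycle (b ∷ L)} a≢b (λ _ → refl) (cycle-transpositions b L u)

cycle-fix : ∀ {m} (L : List (Fin m)) {x} → All (x ≢_) L → cycle L ⟨$⟩ʳ x ≡ x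
cycle-fix [] _ = refl
cycle-fix (a ∷ []) _ = refl
cycle-fix (a ∷ b ∷ L) (x≢a ∷ x≢b ∷ off) =
  trans (cong (transpose a b ⟨$⟩ʳ_) (cycle-fix (b ∷ L) (x≢b ∷ off))) (transpose-fix a b x≢a x≢b)

cycle-invariant : ∀ {m} {A : Set} (f : Fin m → A) {v} L → All (λ x → f x ≡ v) L →
  ∀ x → f (cycle L ⟨$⟩ʳ x) ≡ f x
cycle-invariant f [] _ x = refl
cycle-invariant f (a ∷ []) _ x = refl
cycle-invariant f (a ∷ b ∷ L) (fa ∷ fb ∷ fL) x =
  trans (transpose-invariant f (trans fa (sym fb)) (cycle (b ∷ L) ⟨$⟩ʳ x)) (cycle-invariant f (b ∷ L) (fb ∷ fL) x)

cycle-equivariant : ∀ {m k} (f : Fin m → Fin k) → (∀ {x y} → f x ≡ f y → x ≡ y) → ∀ L x →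
  f (cycle L ⟨$⟩ʳ x) ≡ cycle (map f L) ⟨$⟩ʳ f x
cycle-equivariant f inj [] x = refl
cycle-equivariant f inj (a ∷ []) x = refl
cycle-equivariant f inj (a ∷ b ∷ L) x = trans (transpose-equivariant f inj a b (cycle (b ∷ L) ⟨$⟩ʳ x))
  (cong (transpose (f a) (f b) ⟨$⟩ʳ_) (cycle-equivariant f inj (b ∷ L) x))

iter-fix : ∀ {A : Set} (f : A → A) {x} → f x ≡ x → ∀ k → iter k f x ≡ x
iter-fix f eq zero = refl
iter-fix f eq (suc k) = trans (cong f (iter-fix f eq k)) eq

-- The head `a` is a fixed point of the cycle on the tail, so the transposition in front joins it to
-- that cycle.
cycle-connected : ∀ {m} (a : Fin m) L → Unique (a ∷ L) → ∀ {x} → x ∈ a ∷ L → Orb (cycle (a ∷ L) ∷ []) a x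
cycle-connected a L _ (here refl) = ε
cycle-connected a (b ∷ L) ((a≢b ∷ off) ∷ u) (there x∈) =
  joins C a≢b ¬ab ◅◅ joins-⊇ C a≢b ¬ab (cycle-connected b L u x∈)
  where
  C = cycle (b ∷ L)
  ¬ab : ¬ Orb (C ∷ []) a b
  ¬ab ab with k , eq ← Orb⇒iter C ab =
    a≢b (trans (sym (iter-fix (C ⟨$⟩ʳ_) (cycle-fix (b ∷ L) (a≢b ∷ off)) k)) eq)

lastOf : ∀ {A : Set} → A → List A → A
lastOf b [] = b
lastOf b (c ∷ L) = lastOf c L

cycle-last : ∀ {m} (b : Fin m) L → cycle (b ∷ L) ⟨$⟩ʳ lastOf b L ≡ b
cycle-last b [] = refl
cycle-last b (c ∷ L) = trans (cong (transpose b c ⟨$⟩ʳ_) (cycle-last c L)) (transpose-right b c)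

cycle-snoc : ∀ {m} (b : Fin m) L a → cycle (b ∷ L ++ a ∷ []) ≈ cycle (b ∷ L) · transpose (lastOf b L) a
cycle-snoc b [] a x = refl
cycle-snoc b (c ∷ L) a x = cong (transpose b c ⟨$⟩ʳ_) (cycle-snoc c L a x)

-- By `cycle-snoc` the appended `a` contributes a transposition on the right; moved past `C`, it
-- becomes the transposition of `C (lastOf b L) = b` and `C a = a`.
cycle-rotate₁ : ∀ {m} (a : Fin m) L → All (a ≢_) L → cycle (a ∷ L) ≈ cycle (L ++ a ∷ [])
cycle-rotate₁ a [] _ x = refl
cycle-rotate₁ a (b ∷ L) off x = sym (begin
  cycle (b ∷ L ++ a ∷ []) ⟨$⟩ʳ x ≡⟨ cycle-snoc b L a x ⟩
  C ⟨$⟩ʳ (transpose (lastOf b L) a ⟨$⟩ʳ x)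
    ≡⟨ transpose-equivariant (C ⟨$⟩ʳ_) (perm-injective C) (lastOf b L) a x ⟩
  transpose (C ⟨$⟩ʳ lastOf b L) (C ⟨$⟩ʳ a) ⟨$⟩ʳ (C ⟨$⟩ʳ x)
    ≡⟨ cong₂ (λ u v → transpose u v ⟨$⟩ʳ (C ⟨$⟩ʳ x)) (cycle-last b L) (cycle-fix (b ∷ L) off) ⟩
  transpose b a ⟨$⟩ʳ (C ⟨$⟩ʳ x) ≡⟨ transpose-comm b a (C ⟨$⟩ʳ x) ⟩
  transpose a b ⟨$⟩ʳ (C ⟨$⟩ʳ x) ∎)
  where
  open ≡-Reasoning
  C = cycle (b ∷ L)

cycle-rotate : ∀ {m} (A B : List (Fin m)) → Unique (A ++ B) → cycle (A ++ B) ≈ cycle (B ++ A)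
cycle-rotate [] B _ x = cong (λ L → cycle L ⟨$⟩ʳ x) (sym (++-identityʳ B))
cycle-rotate (a ∷ A) B (off ∷ u) x = begin
  cycle (a ∷ A ++ B) ⟨$⟩ʳ x           ≡⟨ cycle-rotate₁ a (A ++ B) off x ⟩
  cycle ((A ++ B) ++ a ∷ []) ⟨$⟩ʳ x   ≡⟨ cong (λ L → cycle L ⟨$⟩ʳ x) (++-assoc A B (a ∷ [])) ⟩
  cycle (A ++ (B ++ a ∷ [])) ⟨$⟩ʳ x   ≡⟨ cycle-rotate A (B ++ a ∷ []) u′ x ⟩
  cycle ((B ++ a ∷ []) ++ A) ⟨$⟩ʳ x   ≡⟨ cong (λ L → cycle L ⟨$⟩ʳ x) (++-assoc B (a ∷ []) A) ⟩
  cycle (B ++ a ∷ A) ⟨$⟩ʳ x           ∎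
  where
  open ≡-Reasoning
  u′ : Unique (A ++ (B ++ a ∷ []))
  u′ = subst Unique (++-assoc A B (a ∷ []))
    (Unique.++⁺ u ([] ∷ []) (λ { (x∈ , here refl) → All.lookup off x∈ refl }))

module _ {n : ℕ} where

  signed : List (Fin n) → List (Fin (X n))
  signed F = map pos F ++ map ng F

  signed-unique : ∀ F → Unique F → Unique (signed F)
  signed-unique F u = Unique.++⁺ (Unique.map⁺ (↑ˡ-injective n _ _) u) (Unique.map⁺ (↑ʳ-injective n _ _) u) disjoint
    where
    disjoint : ∀ {x} → ¬ (x ∈ map pos F × x ∈ map ng F)
    disjoint (x∈ , x∈′) with i , _ , refl ← ∈-map⁻ pos x∈ with j , _ , eq ← ∈-map⁻ ng x∈′ = pos≢ng eq

  signed-All : ∀ {P : Fin n → Set} F → All P F → All (P ∘ abs) (signed F)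
  signed-All {P} F all = All.++⁺
    (All.map⁺ (All.map (λ {i} → subst P (sym (abs-pos i))) all))
    (All.map⁺ (All.map (λ {i} → subst P (sym (abs-ng i))) all))

  ∈-signed : ∀ F x → abs x ∈ F → x ∈ signed F
  ∈-signed F x x̄∈ with sign {n} x
  ... | is-pos i = ∈-++⁺ˡ (∈-map⁺ pos (subst (_∈ F) (abs-pos i) x̄∈))
  ... | is-ng i = ∈-++⁺ʳ (map pos F) (∈-map⁺ ng (subst (_∈ F) (abs-ng i) x̄∈))

  -- Negation turns the list F, -F into -F, F. This is a rotation, so the cycle stays the same.
  signed-InB : ∀ F → Unique F → InB {n} (cycle (signed F))
  signed-InB F u x = sym (begin
    neg {n} (cycle (signed F) ⟨$⟩ʳ x)                ≡⟨ cycle-equivariant (neg {n}) (neg-injective {n}) (signed F) x ⟩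
    cycle (map (neg {n}) (signed F)) ⟨$⟩ʳ neg {n} x  ≡⟨ cong (λ L → cycle L ⟨$⟩ʳ neg {n} x) negated ⟩
    cycle (map ng F ++ map pos F) ⟨$⟩ʳ neg {n} x     ≡⟨ cycle-rotate (map pos F) (map ng F) (signed-unique F u) (neg {n} x) ⟨
    cycle (signed F) ⟨$⟩ʳ neg {n} x                  ∎)
    where
    open ≡-Reasoning
    negated : map (neg {n}) (signed F) ≡ map ng F ++ map pos F
    negated = trans (map-++ (neg {n}) (map pos F) (map ng F)) (cong₂ _++_
      (trans (sym (map-∘ F)) (map-cong neg-pos F)) (trans (sym (map-∘ F)) (map-cong neg-ng F)))

  -- Words restricted to a block

  transposes-fix : ∀ {A : Set} (f : Fin (X n) → A) {a b x} → f x ≢ f a → f a ≡ f b → transpose a b ⟨$⟩ʳ x ≡ x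
  transposes-fix f x≢a a≡b = transpose-fix _ _ (x≢a ∘ cong f) (λ x≡b → x≢a (trans (cong f x≡b) (sym a≡b)))

  module _ (blk : Fin n → Bool) where

    sblk : Fin (X n) → Bool
    sblk x = blk (abs x)

    sblk-pos : ∀ i → sblk (pos i) ≡ blk i
    sblk-pos i = cong blk (abs-pos i)

    sblk-ng : ∀ i → sblk (ng i) ≡ blk i
    sblk-ng i = cong blk (abs-ng i)

    genBlock : Gen n → Bool
    genBlock (swapG i _ _)    = blk i
    genBlock (swapNegG i _ _) = blk i
    genBlock (flipG i)        = blk i

    gen-invariant : ∀ g → InBlocks blk g → ∀ x → sblk (genPerm g ⟨$⟩ʳ x) ≡ sblk x
    gen-invariant (swapG i j _) eq x = trans
      (transpose-invariant sblk (trans (sblk-pos i) (trans eq (sym (sblk-pos j)))) (transpose (ng i) (ng j) ⟨$⟩ʳ x))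
      (transpose-invariant sblk (trans (sblk-ng i) (trans eq (sym (sblk-ng j)))) x)
    gen-invariant (swapNegG i j _) eq x = trans
      (transpose-invariant sblk (trans (sblk-pos i) (trans eq (sym (sblk-ng j)))) (transpose (ng i) (pos j) ⟨$⟩ʳ x))
      (transpose-invariant sblk (trans (sblk-ng i) (trans eq (sym (sblk-pos j)))) x)
    gen-invariant (flipG i) _ x = transpose-invariant sblk (trans (sblk-pos i) (sym (sblk-ng i))) x

    gen-fix : ∀ g → InBlocks blk g → ∀ x → sblk x ≢ genBlock g → genPerm g ⟨$⟩ʳ x ≡ x
    gen-fix (swapG i j _) eq x off = trans
      (cong (transpose (pos i) (pos j) ⟨$⟩ʳ_)
        (transposes-fix sblk {ng i} {ng j} (λ e → off (trans e (sblk-ng i))) (trans (sblk-ng i) (trans eq (sym (sblk-ng j))))))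
      (transposes-fix sblk {pos i} {pos j} (λ e → off (trans e (sblk-pos i))) (trans (sblk-pos i) (trans eq (sym (sblk-pos j)))))
    gen-fix (swapNegG i j _) eq x off = trans
      (cong (transpose (pos i) (ng j) ⟨$⟩ʳ_)
        (transposes-fix sblk {ng i} {pos j} (λ e → off (trans e (sblk-ng i))) (trans (sblk-ng i) (trans eq (sym (sblk-pos j))))))
      (transposes-fix sblk {pos i} {ng j} (λ e → off (trans e (sblk-pos i))) (trans (sblk-pos i) (trans eq (sym (sblk-ng j)))))
    gen-fix (flipG i) _ x off =
      transposes-fix sblk {pos i} {ng i} (λ e → off (trans e (sblk-pos i))) (trans (sblk-pos i) (sym (sblk-ng i)))

    restrict : Bool → List (Gen n) → List (Gen n)
    restrict b [] = []
    restrict b (g ∷ w) with genBlock g Bool.≟ b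
    ... | yes _ = g ∷ restrict b w
    ... | no  _ = restrict b w

    prod-invariant : ∀ {w} → All (InBlocks blk) w → ∀ x → sblk (prod w ⟨$⟩ʳ x) ≡ sblk x
    prod-invariant [] x = refl
    prod-invariant {g ∷ w} (in-g ∷ in-w) x = trans (gen-invariant g in-g (prod w ⟨$⟩ʳ x)) (prod-invariant in-w x)

    -- A dropped letter acts only on the other block, and the partial product has not left block
    -- `b`.
    restrict-on : ∀ {b w} → All (InBlocks blk) w → ∀ x → sblk x ≡ b →
      prod (restrict b w) ⟨$⟩ʳ x ≡ prod w ⟨$⟩ʳ x
    restrict-on [] x _ = refl
    restrict-on {b} {g ∷ w} (in-g ∷ in-w) x x∈b with genBlock g Bool.≟ b
    ... | yes _ = cong (genPerm g ⟨$⟩ʳ_) (restrict-on in-w x x∈b)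
    ... | no g∉b = trans (restrict-on in-w x x∈b) (sym (gen-fix g in-g (prod w ⟨$⟩ʳ x)
            (λ eq → g∉b (trans (sym eq) (trans (prod-invariant in-w x) x∈b)))))

    restrict-off : ∀ {b w} → All (InBlocks blk) w → ∀ x → sblk x ≢ b → prod (restrict b w) ⟨$⟩ʳ x ≡ x
    restrict-off [] x _ = refl
    restrict-off {b} {g ∷ w} (in-g ∷ in-w) x x∉b with genBlock g Bool.≟ b
    ... | yes g∈b = trans (cong (genPerm g ⟨$⟩ʳ_) (restrict-off in-w x x∉b))
            (gen-fix g in-g x (λ eq → x∉b (trans eq g∈b)))
    ... | no _ = restrict-off in-w x x∉b

    flips-restrict : ∀ w → flips w ≡ flips (restrict true w) + flips (restrict false w)
    flips-restrict [] = refl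
    flips-restrict (g ∷ w) with genBlock g Bool.≟ true | genBlock g Bool.≟ false
    ... | yes t | yes f = contradiction (trans (sym t) f) λ ()
    ... | no ¬t | no ¬f = contradiction (¬-not ¬t) ¬f
    ... | yes _ | no _  = trans (cong (flipCount g +_) (flips-restrict w)) (sym (ℕ.+-assoc (flipCount g) _ _))
    ... | no _  | yes _ = trans (cong (flipCount g +_) (flips-restrict w))
        (exchange (flipCount g) (flips (restrict true w)) (flips (restrict false w)))
      where
      exchange : ∀ x y z → x + (y + z) ≡ y + (x + z)
      exchange = solve-∀

  flipless-even : ∀ w → flips w ≡ 0 → ∃ λ s → TranspositionProduct (2 * s) (prod w)
  flipless-even [] _ = 0 , empty (λ _ → refl)
  flipless-even (swapG i j i<j ∷ w) eq with s , P ← flipless-even w eq =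
    suc s , subst (λ k → TranspositionProduct (suc k) (prod (swapG i j i<j ∷ w))) (sym (ℕ.+-suc s (s + 0)))
      (times {ρ = transpose (ng i) (ng j) · prod w} (i≢j ∘ ↑ˡ-injective n i j) (λ _ → refl)
        (times {ρ = prod w} (i≢j ∘ ↑ʳ-injective n i j) (λ _ → refl) P))
    where
    i≢j : i ≢ j
    i≢j refl = ℕ.<-irrefl refl i<j
  flipless-even (swapNegG i j i<j ∷ w) eq with s , P ← flipless-even w eq =
    suc s , subst (λ k → TranspositionProduct (suc k) (prod (swapNegG i j i<j ∷ w))) (sym (ℕ.+-suc s (s + 0)))
      (times {ρ = transpose (ng i) (pos j) · prod w} pos≢ng (λ _ → refl)
        (times {ρ = prod w} (pos≢ng ∘ sym) (λ _ → refl) P))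

  prod-++ : ∀ (w v : List (Gen n)) → prod (w ++ v) ≈ prod w · prod v
  prod-++ [] v x = refl
  prod-++ (g ∷ w) v x = cong (genPerm g ⟨$⟩ʳ_) (prod-++ w v x)

  flips-++ : ∀ (w v : List (Gen n)) → flips (w ++ v) ≡ flips w + flips v
  flips-++ [] v = refl
  flips-++ (g ∷ w) v = trans (cong (flipCount g +_) (flips-++ w v)) (sym (ℕ.+-assoc (flipCount g) _ _))

-- The permutation γ

module _ (p′ q′ : ℕ) where

  private
    p q n : ℕ
    p = suc p′
    q = suc q′
    n = p + q

  first second : List (Fin (suc p′ + suc q′))
  first  = map (_↑ˡ q) (allFin p)
  second = map (p ↑ʳ_) (allFin q)

  γ₁ γ₂ : Permutation′ (X (suc p′ + suc q′))
  γ₁ = cycle (signed first)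
  γ₂ = cycle (signed second)

  inFirst : Fin (suc p′ + suc q′) → Bool
  inFirst i = [ (λ _ → true) , (λ _ → false) ]′ (splitAt p i)

  block : Fin (X (suc p′ + suc q′)) → Bool
  block = sblk {n} inFirst

  first-unique : Unique first
  first-unique = Unique.map⁺ (↑ˡ-injective q _ _) (Unique.allFin⁺ p)

  second-unique : Unique second
  second-unique = Unique.map⁺ (↑ʳ-injective p _ _) (Unique.allFin⁺ q)

  first-block : All (λ i → inFirst i ≡ true) first
  first-block = All.map⁺ (All.universal (λ i → cong [ (λ _ → true) , (λ _ → false) ]′ (splitAt-↑ˡ p i q)) (allFin p))

  second-block : All (λ i → inFirst i ≡ false) second
  second-block = All.map⁺ (All.universal (λ i → cong [ (λ _ → true) , (λ _ → false) ]′ (splitAt-↑ʳ p q i)) (allFin q))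

  ∈-first : ∀ i → inFirst i ≡ true → i ∈ first
  ∈-first i eq with splitAt p i | join-splitAt p q i
  ... | inj₁ j | refl = ∈-map⁺ (_↑ˡ q) (∈-allFin j)

  ∈-second : ∀ i → inFirst i ≡ false → i ∈ second
  ∈-second i eq with splitAt p i | join-splitAt p q i
  ... | inj₂ j | refl = ∈-map⁺ (p ↑ʳ_) (∈-allFin j)

  signed-first-block : All (λ x → block x ≡ true) (signed first)
  signed-first-block = signed-All first first-block

  signed-second-block : All (λ x → block x ≡ false) (signed second)
  signed-second-block = signed-All second second-block

  γ₁-fix : ∀ x → block x ≡ false → γ₁ ⟨$⟩ʳ x ≡ x
  γ₁-fix x eq = cycle-fix (signed first)
    (All.map (λ { t refl → contradiction (trans (sym eq) t) λ () }) signed-first-block)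

  γ₂-fix : ∀ x → block x ≡ true → γ₂ ⟨$⟩ʳ x ≡ x
  γ₂-fix x eq = cycle-fix (signed second)
    (All.map (λ { t refl → contradiction (trans (sym eq) t) λ () }) signed-second-block)

  γ-on-first : ∀ x → block x ≡ true → γ p q ⟨$⟩ʳ x ≡ γ₁ ⟨$⟩ʳ x
  γ-on-first x eq = cong (γ₁ ⟨$⟩ʳ_) (γ₂-fix x eq)

  γ-on-second : ∀ x → block x ≡ false → γ p q ⟨$⟩ʳ x ≡ γ₂ ⟨$⟩ʳ x
  γ-on-second x eq = γ₁-fix (γ₂ ⟨$⟩ʳ x) (trans (cycle-invariant block (signed second) signed-second-block x) eq)

  γ-block : ∀ x → block (γ p q ⟨$⟩ʳ x) ≡ block x
  γ-block x = trans (cycle-invariant block (signed first) signed-first-block (γ₂ ⟨$⟩ʳ x))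
    (cycle-invariant block (signed second) signed-second-block x)

  γ-InB : InB {suc p′ + suc q′} (γ (suc p′) (suc q′))
  γ-InB = InB-· {n} {γ₁} {γ₂} (signed-InB first first-unique) (signed-InB second second-unique)

  -- On the first block `γ₁` agrees with γ, and elsewhere it does not move.
  γ₁⊆γ : ∀ {x y} → Orb (γ₁ ∷ []) x y → Orb (γ p q ∷ []) x y
  γ₁⊆γ = Orb-map (γ₁ ∷ []) (γ p q ∷ []) id λ { {x} (here refl) → one x (block x) refl }
    where
    one : ∀ x b → block x ≡ b → Orb (γ p q ∷ []) x (γ₁ ⟨$⟩ʳ x)
    one x true eq = fwd (here (γ-on-first x eq)) ◅ ε
    one x false eq = subst (Orb (γ p q ∷ []) x) (sym (γ₁-fix x eq)) ε

  γ₂⊆γ : ∀ {x y} → Orb (γ₂ ∷ []) x y → Orb (γ p q ∷ []) x y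
  γ₂⊆γ = Orb-map (γ₂ ∷ []) (γ p q ∷ []) id λ { {x} (here refl) → one x (block x) refl }
    where
    one : ∀ x b → block x ≡ b → Orb (γ p q ∷ []) x (γ₂ ⟨$⟩ʳ x)
    one x false eq = fwd (here (γ-on-second x eq)) ◅ ε
    one x true eq = subst (Orb (γ p q ∷ []) x) (sym (γ₂-fix x eq)) ε

  base : Bool → Fin (X (suc p′ + suc q′))
  base true  = pos {n} (zero ↑ˡ q)
  base false = pos {n} (p ↑ʳ zero)

  base-connected : ∀ b x → block x ≡ b → Orb (γ p q ∷ []) (base b) x
  base-connected true x eq = γ₁⊆γ (cycle-connected _ _ (signed-unique first first-unique)
    (∈-signed first x (∈-first (abs x) eq)))
  base-connected false x eq = γ₂⊆γ (cycle-connected _ _ (signed-unique second second-unique)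
    (∈-signed second x (∈-second (abs x) eq)))

  block-connected : ∀ x y → block x ≡ block y → Orb (γ p q ∷ []) x y
  block-connected x y eq = Orb-euclidean (γ p q ∷ []) (base-connected (block x) x refl)
    (base-connected (block x) y (sym eq))

  side : Bool → Fin 2
  side true  = zero
  side false = suc zero

  side-injective : ∀ {b c} → side b ≡ side c → b ≡ c
  side-injective {true}  {true}  _ = refl
  side-injective {false} {false} _ = refl

  unside : Fin 2 → Bool
  unside zero       = true
  unside (suc zero) = false

  side-unside : ∀ i → side (unside i) ≡ i
  side-unside zero       = refl
  side-unside (suc zero) = refl

  block-base : ∀ b → block (base b) ≡ b
  block-base true  = trans (sblk-pos inFirst (zero ↑ˡ q)) (cong [ (λ _ → true) , (λ _ → false) ]′ (splitAt-↑ˡ p zero q))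
  block-base false = trans (sblk-pos inFirst (p ↑ʳ zero)) (cong [ (λ _ → true) , (λ _ → false) ]′ (splitAt-↑ʳ p q zero))

  #γ : #₁ (γ (suc p′) (suc q′)) ≡ 2
  #γ = classes-unique (orbits (γ p q ∷ [])) record
    { cls = side ∘ block
    ; rep = base ∘ unside
    ; cls-rep = λ i → trans (cong side (block-base (unside i))) (side-unside i)
    ; sound = Orb-least (γ p q ∷ []) (side ∘ block) (λ { {x} (here refl) → cong side (sym (γ-block x)) })
    ; complete = λ {x} {y} eq → block-connected x y (side-injective eq)
    }

  module _ {γ̄ : Permutation′ (suc p′ + suc q′)} (C : Covers (γ (suc p′) (suc q′)) γ̄) where

    γ̄-block : ∀ i → inFirst (γ̄ ⟨$⟩ʳ i) ≡ inFirst i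
    γ̄-block i = subst (λ j → inFirst (γ̄ ⟨$⟩ʳ j) ≡ inFirst j) (abs-pos i)
      (trans (cong inFirst (sym (Covers.lifts C (pos i)))) (γ-block (pos i)))

    -- Any quotient of γ is allowed, because the one that will occur is the product `τ̄ · κ̄`.
    #γ̄ : #₁ γ̄ ≡ 2
    #γ̄ = classes-unique (orbits (γ̄ ∷ [])) record
      { cls = side ∘ inFirst
      ; rep = abs ∘ base ∘ unside
      ; cls-rep = λ i → trans (cong side (block-base (unside i))) (side-unside i)
      ; sound = Orb-least (γ̄ ∷ []) (side ∘ inFirst) (λ { {i} (here refl) → cong side (sym (γ̄-block i)) })
      ; complete = λ {i} {j} eq → subst (λ k → Orb (γ̄ ∷ []) k j) (abs-pos i)
          (subst (Orb (γ̄ ∷ []) (abs (pos i))) (abs-pos j)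
            (covers-Orb⁺ {n} {γ p q} {γ̄} C (block-connected (pos i) (pos j)
              (trans (sblk-pos inFirst i) (trans (side-injective eq) (sym (sblk-pos inFirst j)))))))
      }

  signed-length : ∀ F → length (signed {n} F) ≡ 2 * length F
  signed-length F = trans (length-++ (map (pos {n}) F)) (trans (cong₂ _+_ (length-map pos F) (length-map ng F))
    (cong (length F +_) (sym (ℕ.+-identityʳ (length F)))))

  odd-length : ∀ k {l} → suc l ≡ 2 * suc k → l ≡ suc (2 * k)
  odd-length k eq = trans (ℕ.suc-injective eq) (ℕ.+-suc k (k + 0))

  -- The cycle has 2p entries and thus takes 2p - 1 = 2p′ + 1 transpositions.
  γ₁-odd : TranspositionProduct (suc (2 * p′)) γ₁
  γ₁-odd = subst (λ k → TranspositionProduct k γ₁)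
    (odd-length p′ (trans (signed-length first) (cong (2 *_) (trans (length-map (_↑ˡ q) (allFin p)) (length-tabulate id)))))
    (cycle-transpositions _ _ (signed-unique first first-unique))

  γ₂-odd : TranspositionProduct (suc (2 * q′)) γ₂
  γ₂-odd = subst (λ k → TranspositionProduct k γ₂)
    (odd-length q′ (trans (signed-length second) (cong (2 *_) (trans (length-map (p ↑ʳ_) (allFin q)) (length-tabulate id)))))
    (cycle-transpositions _ _ (signed-unique second second-unique))

  -- Each of the two cycles of γ is an odd permutation, while a generator
  -- other than a flip is even; so each block contains a flip.
  two-flips : ∀ w → prod w ≈ γ p q → All (InBlocks inFirst) w → 2 ≤ flips w
  two-flips w w≈γ in-w = subst (2 ≤_) (sym (flips-restrict inFirst w)) (ℕ.+-mono-≤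
    (positive (restrict inFirst true w) {r = p′} restrict-true γ₁-odd)
    (positive (restrict inFirst false w) {r = q′} restrict-false γ₂-odd))
    where
    positive : ∀ v {σ r} → prod v ≈ σ → TranspositionProduct (suc (2 * r)) σ → 1 ≤ flips v
    positive v {σ} {r} v≈σ odd with flips v in eq
    ... | suc _ = s≤s z≤n
    ... | zero with s , even ← flipless-even v eq =
      contradiction (TranspositionProduct-≈ {σ = σ} {prod v} (sym ∘ v≈σ) even) (odd≢even {r = r} {s} odd)
    restrict-true : prod (restrict inFirst true w) ≈ γ₁
    restrict-true x with block x in eq
    ... | true = trans (restrict-on inFirst in-w x eq) (trans (w≈γ x) (γ-on-first x eq))
    ... | false = trans (restrict-off inFirst in-w x (λ t → contradiction (trans (sym eq) t) λ ())) (sym (γ₁-fix x eq))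
    restrict-false : prod (restrict inFirst false w) ≈ γ₂
    restrict-false x with block x in eq
    ... | false = trans (restrict-on inFirst in-w x eq) (trans (w≈γ x) (γ-on-second x eq))
    ... | true = trans (restrict-off inFirst in-w x (λ t → contradiction (trans (sym eq) t) λ ())) (sym (γ₂-fix x eq))

-- Arithmetic behind the two inclusions

≢-≢⇒≡ : ∀ {a b c : Bool} → b ≢ a → c ≢ a → b ≡ c
≢-≢⇒≡ b≢a c≢a = trans (¬-not b≢a) (sym (¬-not c≢a))

-- a and b are the lengths of τ and τ⁻¹γ; A, A′, K, K′ are the orbit counts of
-- τ, τ⁻¹γ on X and of the permutations they induce on {1..n}; f counts flips.
module _ (n A A′ K K′ a b c : ℕ) (len-a : a + A ≡ n + A′) (len-b : b + K ≡ n + K′)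
    (gen : A′ + K′ + 2 ≤ n + 2 * c) where

  total : (a + b) + (A + K) ≡ (n + n) + (A′ + K′)
  total = trans (interchange a b A K) (trans (cong₂ _+_ len-a len-b) (sym (interchange n n A′ K′)))
    where
    interchange : ∀ u v x y → (u + v) + (x + y) ≡ (u + x) + (v + y)
    interchange = solve-∀

  -- Inserting the sum of the two length formulas into the genus bound yields a + b ≤ n; the assumed
  -- reverse inequality is the triangle inequality, n being the length of γ.
  noncrossing⇒additive : A + K + 2 ≡ n + n + 2 * c → n ≤ a + b → a + b ≡ n
  noncrossing⇒additive nc n≤ = ℕ.≤-antisym (ℕ.+-cancelʳ-≤ (n + n + 2 * c) _ _ (begin
    (a + b) + (n + n + 2 * c)  ≡⟨ cong ((a + b) +_) nc ⟨
    (a + b) + (A + K + 2)      ≡⟨ ℕ.+-assoc (a + b) (A + K) 2 ⟨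
    (a + b) + (A + K) + 2      ≡⟨ cong (_+ 2) total ⟩
    (n + n) + (A′ + K′) + 2    ≡⟨ ℕ.+-assoc (n + n) (A′ + K′) 2 ⟩
    (n + n) + (A′ + K′ + 2)    ≤⟨ ℕ.+-monoʳ-≤ (n + n) gen ⟩
    (n + n) + (n + 2 * c)      ≡⟨ rearrange n (2 * c) ⟩
    n + (n + n + 2 * c)        ∎)) n≤
    where
    open ℕ.≤-Reasoning
    rearrange : ∀ x y → (x + x) + (x + y) ≡ x + (x + x + y)
    rearrange = solve-∀

  -- Additivity gives A + K = n + A′ + K′, and the flip counts turn this into A′ + K′ = n + f + g.
  -- The genus bound now reads f + g + 2 ≤ 2c, so the last hypothesis makes it an equality.
  additive⇒noncrossing : ∀ f g → f + A ≡ 2 * A′ → g + K ≡ 2 * K′ → a + b ≡ n → 2 * c ≤ (f + g) + 2 →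
    A + K + 2 ≡ n + n + 2 * c
  additive⇒noncrossing f g fl-f fl-g a+b≡n 2c≤ = begin-equality
    A + K + 2               ≡⟨ cong (_+ 2) A+K ⟩
    n + (A′ + K′) + 2       ≡⟨ cong (λ k → n + k + 2) A′+K′ ⟩
    n + (n + (f + g)) + 2   ≡⟨ rearrange₃ n (f + g) ⟩
    n + n + ((f + g) + 2)   ≡⟨ cong (n + n +_) 2c≡ ⟩
    n + n + 2 * c           ∎
    where
    open ℕ.≤-Reasoning
    rearrange₁ : ∀ x u y v w → w + ((x + u) + (y + v)) ≡ (x + y) + (w + (u + v))
    rearrange₁ = solve-∀
    rearrange₂ : ∀ x u v → x + (2 * u + 2 * v) ≡ (u + v) + (x + (u + v))
    rearrange₂ = solve-∀
    rearrange₃ : ∀ x y → x + (x + y) + 2 ≡ x + x + (y + 2)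
    rearrange₃ = solve-∀
    rearrange₄ : ∀ x y → (x + y) + 2 ≡ x + (y + 2)
    rearrange₄ = solve-∀
    A+K : A + K ≡ n + (A′ + K′)
    A+K = ℕ.+-cancelˡ-≡ n _ _ (trans (cong (_+ (A + K)) (sym a+b≡n)) (trans total (ℕ.+-assoc n n (A′ + K′))))
    A′+K′ : A′ + K′ ≡ n + (f + g)
    A′+K′ = ℕ.+-cancelʳ-≡ (n + (A′ + K′)) _ _ (begin-equality
      (A′ + K′) + (n + (A′ + K′))     ≡⟨ rearrange₂ n A′ K′ ⟨
      n + (2 * A′ + 2 * K′)           ≡⟨ cong₂ (λ u v → n + (u + v)) fl-f fl-g ⟨
      n + ((f + A) + (g + K))         ≡⟨ rearrange₁ f A g K n ⟩
      (f + g) + (n + (A + K))         ≡⟨ cong (λ k → (f + g) + (n + k)) A+K ⟩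
      (f + g) + (n + (n + (A′ + K′))) ≡⟨ rearrange₅ (f + g) n (n + (A′ + K′)) ⟩
      n + (f + g) + (n + (A′ + K′))   ∎)
      where
      rearrange₅ : ∀ x y z → x + (y + z) ≡ y + x + z
      rearrange₅ = solve-∀
    2c≡ : (f + g) + 2 ≡ 2 * c
    2c≡ = ℕ.≤-antisym (ℕ.+-cancelˡ-≤ n _ _ (begin
      n + ((f + g) + 2)    ≡⟨ rearrange₄ n (f + g) ⟨
      n + (f + g) + 2      ≡⟨ cong (_+ 2) A′+K′ ⟨
      A′ + K′ + 2          ≤⟨ gen ⟩
      n + 2 * c            ∎)) 2c≤

-- The two inclusions for a fixed signed permutation

module Main (p′ q′ : ℕ) (τ : Permutation′ (X (suc p′ + suc q′))) (τB : InB {suc p′ + suc q′} τ) where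

  private
    n : ℕ
    n = suc p′ + suc q′
    Γ κ : Permutation′ (X n)
    Γ = γ (suc p′) (suc q′)
    κ = τ ⁻¹ · Γ
    blk : Fin n → Bool
    blk = inFirst p′ q′

  τκ≈γ : τ · κ ≈ Γ
  τκ≈γ x = inverseʳ τ

  κB : InB {n} κ
  κB = InB-· {n} {τ ⁻¹} {Γ} (InB-inverse {n} {τ} τB) (γ-InB p′ q′)

  τ̄ κ̄ : Permutation′ n
  τ̄ = proj₁ (quotient {n} {τ} τB)
  κ̄ = proj₁ (quotient {n} {κ} κB)

  τ-covers : Covers τ τ̄
  τ-covers = proj₂ (quotient {n} {τ} τB)

  κ-covers : Covers κ κ̄
  κ-covers = proj₂ (quotient {n} {κ} κB)

  γ-covers : Covers Γ (τ̄ · κ̄)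
  γ-covers = covers-≈ {n} {τ · κ} {Γ} {τ̄ · κ̄} τκ≈γ (covers-· {n} {τ} {κ} {τ̄} {κ̄} τ-covers κ-covers)

  -- A step of γ projects to a step of `κ̄` followed by one of `τ̄`, so absolute values map the
  -- orbits of τ and γ onto those of `τ̄` and `κ̄`; the latter are at most as many.
  quotient-genus : #₁ τ̄ + #₁ κ̄ + 2 ≤ n + 2 * #₂ τ Γ
  quotient-genus = begin
    #₁ τ̄ + #₁ κ̄ + 2              ≡⟨ cong (#₁ τ̄ + #₁ κ̄ +_) (#γ̄ p′ q′ {τ̄ · κ̄} γ-covers) ⟨
    #₁ τ̄ + #₁ κ̄ + #₁ (τ̄ · κ̄)    ≤⟨ genus τ̄ κ̄ ⟩
    n + 2 * #₂ τ̄ κ̄               ≤⟨ ℕ.+-monoʳ-≤ n (ℕ.*-monoʳ-≤ 2 fewer) ⟩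
    n + 2 * #₂ τ Γ                ∎
    where
    open ℕ.≤-Reasoning
    project : ∀ {x y} → Step (τ ∷ Γ ∷ []) x y → Orb (τ̄ ∷ κ̄ ∷ []) (abs {n} x) (abs {n} y)
    project {x} (here refl) = fwd (here (sym (Covers.lifts τ-covers x))) ◅ ε
    project {x} (there (here refl)) =
      fwd (there (here refl)) ◅ fwd (here (sym (Covers.lifts γ-covers x))) ◅ ε
    fewer : #₂ τ̄ κ̄ ≤ #₂ τ Γ
    fewer = classes-≤ (orbits (τ ∷ Γ ∷ [])) (orbits (τ̄ ∷ κ̄ ∷ [])) (abs {n})
      (Orb-map (τ ∷ Γ ∷ []) (τ̄ ∷ κ̄ ∷ []) (abs {n}) project)
      (λ i → pos i , subst (λ j → Orb (τ̄ ∷ κ̄ ∷ []) j i) (sym (abs-pos i)) ε)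

  #₂≤2 : #₂ τ Γ ≤ 2
  #₂≤2 = ℕ.≤-trans (numOrbits-≤ (Γ ∷ []) (τ ∷ Γ ∷ []) (λ s → fwd (there s) ◅ ε)) (ℕ.≤-reflexive (#γ p′ q′))

  #₂≤1 : ∀ i → blk (τ̄ ⟨$⟩ʳ i) ≢ blk i → #₂ τ Γ ≤ 1
  -- The single class of a one-point set is mapped to the orbit of `pos i`, which has to be
  -- everything: τ leads across from one cycle of γ to the other.
  #₂≤1 i crosses = classes-≤ point (orbits (τ ∷ Γ ∷ [])) (λ _ → pos i) (λ _ → ε)
    (λ s → zero , reach-all s (block p′ q′ s Bool.≟ block p′ q′ (pos i)))
    where
    point : Classes {1} _≡_ 1
    point = record { cls = id ; rep = id ; cls-rep = λ _ → refl ; sound = id ; complete = id }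
    along-γ : ∀ x y → block p′ q′ x ≡ block p′ q′ y → Orb (τ ∷ Γ ∷ []) x y
    along-γ x y eq = Orb-map (Γ ∷ []) (τ ∷ Γ ∷ []) id (λ s → fwd (there s) ◅ ε) (block-connected p′ q′ x y eq)
    crossed : block p′ q′ (τ ⟨$⟩ʳ pos i) ≢ block p′ q′ (pos i)
    crossed eq = crosses (trans (cong (λ j → blk (τ̄ ⟨$⟩ʳ j)) (sym (abs-pos i)))
      (trans (cong blk (sym (Covers.lifts τ-covers (pos i)))) (trans eq (sblk-pos blk i))))
    reach-all : ∀ s → Dec (block p′ q′ s ≡ block p′ q′ (pos i)) → Orb (τ ∷ Γ ∷ []) (pos i) s
    reach-all s (yes eq) = along-γ (pos i) s (sym eq)
    reach-all s (no neq) = fwd (here refl) ◅ along-γ (τ ⟨$⟩ʳ pos i) s (≢-≢⇒≡ crossed neq)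

  -- The concatenated words multiply to γ, and `length-lower` gives n for γ since both of its orbit
  -- counts are 2.
  triangle : ∀ {a b} → ProductOf {n} τ a → ProductOf {n} κ b → n ≤ a + b
  triangle {a} {b} (w , refl , w≈) (v , refl , v≈) = ℕ.+-cancelʳ-≤ 2 _ _ (begin
    n + 2                 ≡⟨ cong (n +_) (#γ̄ p′ q′ {τ̄ · κ̄} γ-covers) ⟨
    n + #₁ (τ̄ · κ̄)        ≤⟨ length-lower {n} {Γ} {τ̄ · κ̄} γ-covers (w ++ v , length-++ w , wv≈) ⟩
    #₁ Γ + (a + b)        ≡⟨ cong (_+ (a + b)) (#γ p′ q′) ⟩
    2 + (a + b)           ≡⟨ ℕ.+-comm 2 (a + b) ⟩
    (a + b) + 2           ∎)
    where
    open ℕ.≤-Reasoning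
    wv≈ : prod (w ++ v) ≈ Γ
    wv≈ x = trans (prod-++ w v x) (trans (w≈ (prod v ⟨$⟩ʳ x)) (trans (cong (τ ⟨$⟩ʳ_) (v≈ x)) (τκ≈γ x)))

  noncrossing⇒≤B : NonCrossing τ Γ → _≤B_ {n} τ Γ
  noncrossing⇒≤B nc = a , b , hasA , hasB ,
    hasLength⁺ {n} {Γ} {τ̄ · κ̄} γ-covers (cong₂ _+_ a+b≡n (trans (#γ p′ q′) (sym (#γ̄ p′ q′ {τ̄ · κ̄} γ-covers))))
    where
    module T = Reduced (reduced₀ {n} {τ} {τ̄} τ-covers)
    module K = Reduced (reduced₀ {n} {κ} {κ̄} κ-covers)
    a = length T.word
    b = length K.word
    hasA : HasLength {n} τ a
    hasA = hasLength⁺ {n} {τ} {τ̄} τ-covers T.word-length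
    hasB : HasLength {n} κ b
    hasB = hasLength⁺ {n} {κ} {κ̄} κ-covers K.word-length
    a+b≡n : a + b ≡ n
    a+b≡n = noncrossing⇒additive n (#₁ τ) (#₁ τ̄) (#₁ κ) (#₁ κ̄) a b (#₂ τ Γ) T.word-length K.word-length
      quotient-genus (trans (cong (#₁ τ + #₁ κ +_) (sym (#γ p′ q′))) nc) (triangle (proj₁ hasA) (proj₁ hasB))

  ≤B⇒noncrossing : _≤B_ {n} τ Γ → NonCrossing τ Γ
  ≤B⇒noncrossing (a , b , hasA , hasB , hasAB) = by-cases (all? (λ i → blk (τ̄ ⟨$⟩ʳ i) Bool.≟ blk i))
    where
    a+b≡n : a + b ≡ n
    a+b≡n = ℕ.+-cancelʳ-≡ 2 _ _ (trans (cong (a + b +_) (sym (#γ p′ q′)))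
      (trans (hasLength⁻ {n} {Γ} {τ̄ · κ̄} γ-covers hasAB) (cong (n +_) (#γ̄ p′ q′ {τ̄ · κ̄} γ-covers))))
    conclude : ∀ {bt bk} (Rτ : Reduced bt τ τ̄) (Rκ : Reduced bk κ κ̄) →
      2 * #₂ τ Γ ≤ flips (Reduced.word Rτ) + flips (Reduced.word Rκ) + 2 → NonCrossing τ Γ
    conclude Rτ Rκ 2c≤ = trans (cong (#₁ τ + #₁ κ +_) (#γ p′ q′))
      (additive⇒noncrossing n (#₁ τ) (#₁ τ̄) (#₁ κ) (#₁ κ̄) a b (#₂ τ Γ)
        (hasLength⁻ {n} {τ} {τ̄} τ-covers hasA) (hasLength⁻ {n} {κ} {κ̄} κ-covers hasB) quotient-genus
        (flips (Reduced.word Rτ)) (flips (Reduced.word Rκ)) (Reduced.word-flips Rτ) (Reduced.word-flips Rκ) a+b≡n 2c≤)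
    by-cases : Dec (∀ i → blk (τ̄ ⟨$⟩ʳ i) ≡ blk i) → NonCrossing τ Γ
    -- A crossing gives c ≤ 1, so 2c ≤ 2 whatever the number of flips, and words without block
    -- condition suffice.
    by-cases (no ¬preserved) with i , crosses ← ¬∀⟶∃¬ n _ (λ i → blk (τ̄ ⟨$⟩ʳ i) Bool.≟ blk i) ¬preserved =
      conclude (reduced₀ {n} {τ} {τ̄} τ-covers) (reduced₀ {n} {κ} {κ̄} κ-covers)
        (ℕ.≤-trans (ℕ.*-monoʳ-≤ 2 (#₂≤1 i crosses)) (ℕ.m≤n+m 2 _))
    -- Both words respect the blocks and together they spell γ, so `two-flips` supplies the 2 that c
    -- = 2 calls for.
    by-cases (yes preserved) = conclude Rτ Rκ (ℕ.≤-trans (ℕ.*-monoʳ-≤ 2 #₂≤2) (ℕ.+-monoˡ-≤ 2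
        (subst (2 ≤_) (flips-++ (word Rτ) (word Rκ)) (two-flips p′ q′ (word Rτ ++ word Rκ) prod≈
          (All.++⁺ (word-blocks Rτ) (word-blocks Rκ))))))
      where
      open Reduced
      Rτ : Reduced blk τ τ̄
      Rτ = reduced {n} blk {τ} {τ̄} τ-covers preserved
      Rκ : Reduced blk κ κ̄
      Rκ = reduced {n} blk {κ} {κ̄} κ-covers
        -- The quotient `κ̄` preserves the blocks because `τ̄` and the product `τ̄ · κ̄` do.
        (λ i → trans (sym (preserved (κ̄ ⟨$⟩ʳ i))) (γ̄-block p′ q′ {τ̄ · κ̄} γ-covers i))
      prod≈ : prod (word Rτ ++ word Rκ) ≈ Γ
      prod≈ x = trans (prod-++ (word Rτ) (word Rκ) x)
        (trans (word-prod Rτ (prod (word Rκ) ⟨$⟩ʳ x)) (trans (cong (τ ⟨$⟩ʳ_) (word-prod Rκ x)) (τκ≈γ x)))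

theorem1p1 : (p q : ℕ) → 1 ≤ p → 1 ≤ q →
    (τ : Permutation′ (X (p + q))) →
    (InB {p + q} τ × NonCrossing τ (γ p q)) ⇔ (InB {p + q} τ × _≤B_ {p + q} τ (γ p q))
theorem1p1 (suc p′) (suc q′) _ _ τ = mk⇔
  (λ (τB , nc) → τB , Main.noncrossing⇒≤B p′ q′ τ τB nc)
  (λ (τB , le) → τB , Main.≤B⇒noncrossing p′ q′ τ τB le)
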